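{- Let $w_1,w_2,w_3$ be any odd positive integers. Then for every integer $n\ge 0$ and every $y_1\in\mathbb{Z}_p$, the following six expressions are equal: \begin{align*} &w_1^n\sum_{k=0}^{n}\binom{n}{k}\sum_{a=0}^{w_1d-1}(-1)^a\chi(a)E_{k,\chi}\Big(w_2y_1+\frac{w_2}{w_1}a\Big)T_{n-k}(w_3d-1,\chi)w_2^{n-k}w_3^k\\ =&w_1^n\sum_{k=0}^{n}\binom{n}{k}\sum_{a=0}^{w_1d-1}(-1)^a\chi(a)E_{k,\chi}\Big(w_3y_1+\frac{w_3}{w_1}a\Big)T_{n-k}(w_2d-1,\chi)w_3^{n-k}w_2^k\\ =&w_2^n\sum_{k=0}^{n}\binom{n}{k}\sum_{a=0}^{w_2d-1}(-1)^a\chi(a)E_{k,\chi}\Big(w_1y_1+\frac{w_1}{w_2}a\Big)T_{n-k}(w_3d-1,\chi)w_1^{n-k}w_3^k\\ =&w_2^n\sum_{k=0}^{n}\binom{n}{k}\sum_{a=0}^{w_2d-1}(-1)^a\chi(a)E_{k,\chi}\Big(w_3y_1+\frac{w_3}{w_2}a\Big)T_{n-k}(w_1d-1,\chi)w_3^{n-k}w_1^k\\ =&w_3^n\sum_{k=0}^{n}\binom{n}{k}\sum_{a=0}^{w_3d-1}(-1)^a\chi(a)E_{k,\chi}\Big(w_1y_1+\frac{w_1}{w_3}a\Big)T_{n-k}(w_2d-1,\chi)w_1^{n-k}w_2^k\\ =&w_3^n\sum_{k=0}^{n}\binom{n}{k}\sum_{a=0}^{w_3d-1}(-1)^a\chi(a)E_{k,\chi}\Big(w_2y_1+\frac{w_2}{w_3}a\Big)T_{n-k}(w_1d-1,\chi)w_2^{n-k}w_1^k.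 \end{align*}
   Context: $p$ is a fixed odd prime, $\mathbb{Z}_p$ is the ring of $p$-adic integers, and $\mathbb{C}_p$ is the completion of an algebraic closure of $\mathbb{Q}_p$. $d$ is a fixed odd positive integer and $\chi$ is a (primitive) Dirichlet character of conductor $d$, with values in $\overline{\mathbb{Q}}$, regarded as $\mathbb{C}_p$-valued through a fixed embedding $\overline{\mathbb{Q}}\to\mathbb{C}_p$; as usual $\chi(a)=0$ when $\gcd(a,d)>1$ (and $\chi\equiv 1$ if $d=1$). The generalized Euler polynomials $E_{n,\chi}(x)$ attached to $\chi$ are the polynomials in $x$ (with coefficients in $\mathbb{C}_p$, so they can be evaluated at any element of $\mathbb{C}_p$) defined by $$\frac{2e^{xt}}{e^{dt}+1}\sum_{a=0}^{d-1}(-1)^a\chi(a)e^{at}=\sum_{n=0}^{\infty}E_{n,\chi}(x)\frac{t^n}{n!}.$$ For integers $k,n\ge 0$, the $k$th alternating generalized power sum attached to $\chi$ is $T_k(n,\chi)=\sum_{a=0}^{n}(-1)^a\chi(a)a^k$, with the convention $0^0=1$. -}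

module Defs where

open import Level using (Level; _⊔_) renaming (suc to lsuc)
open import Algebra.Bundles using (CommutativeRing)
open import Algebra.Bundles.Raw using (RawRing)
open import Algebra.Apartness.Bundles using (HeytingField; HeytingCommutativeRing)
open import Algebra.Morphism.Structures using (IsRingHomomorphism)
import Algebra.Definitions.RawSemiring as RawSemiringDefinitions
open import Data.Fin.Base using (toℕ)
open import Data.Integer.Base as ℤ using (ℤ; +_)
import Data.Integer.Coprimality as ℤ
import Data.Integer.Divisibility as ℤ
open import Data.List.Base using (List; []; _∷_; [_]; _++_; map)
open import Data.Nat.Base as ℕ using (ℕ; zero; suc; NonZero; _!; _∸_)
open import Data.Nat.Combinatorics using (_C_)
open import Data.Nat.Divisibility using (_∣_)
open import Data.Nat.Properties using (_!≢0)
open import Data.Product.Base using (_,_; ∃-syntax)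
open import Data.Rational.Base as ℚ using (ℚ; 0ℚ; 1ℚ; ½)
open import Data.Rational.Properties as ℚ using ()
open import Data.Vec.Base using (Vec; []; _∷_; head; lookup)
open import Relation.Binary.PropositionalEquality.Core using (_≡_)
open import Relation.Nullary.Negation using (¬_)

private
  variable
    c ℓ ℓ₁ ℓ₂ c′ ℓ₁′ ℓ₂′ : Level

Odd : ℕ → Set
Odd n = ¬ (2 ∣ n)

------------------------------------------------------------------------
-- Polynomials and formal power series

module RingOps (R : RawRing c ℓ) where
  open RawRing R public
  open RawSemiringDefinitions rawSemiring public using (_×_; _^_; sum)

  infixl 6 _-_
  _-_ : Carrier → Carrier → Carrier
  x - y = x + (- y)

  ∑ : ℕ → (ℕ → Carrier) → Carrier
  ∑ n f = sum {n} (λ i → f (toℕ i))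

  syntax ∑ n (λ a → x) = ∑[ a < n ] x

  fromℕ : ℕ → Carrier
  fromℕ n = n × 1#

-- A polynomial is the list of its coefficients, constant term first;
-- trailing zeros are allowed and are invisible to the equality below.
module Polynomials (R : RawRing c ℓ) where
  open RingOps R

  Poly : Set c
  Poly = List Carrier

  coeff : Poly → ℕ → Carrier
  coeff []      _       = 0#
  coeff (a ∷ f) zero    = a
  coeff (a ∷ f) (suc i) = coeff f i

  infixl 6 _+ᵖ_
  _+ᵖ_ : Poly → Poly → Poly
  []      +ᵖ g       = g
  (a ∷ f) +ᵖ []      = a ∷ f
  (a ∷ f) +ᵖ (b ∷ g) = (a + b) ∷ (f +ᵖ g)

  infixl 7 _*ᵖ_
  _*ᵖ_ : Poly → Poly → Poly
  []      *ᵖ g = []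
  (a ∷ f) *ᵖ g = map (a *_) g +ᵖ (0# ∷ f *ᵖ g)

  polyRing : RawRing c ℓ
  polyRing = record
    { Carrier = Poly
    ; _≈_     = λ f g → ∀ i → coeff f i ≈ coeff g i
    ; _+_     = _+ᵖ_
    ; _*_     = _*ᵖ_
    ; -_      = map (-_)
    ; 0#      = []
    ; 1#      = [ 1# ]
    }

  X : Poly
  X = 0# ∷ 1# ∷ []

  eval : Poly → Carrier → Carrier
  eval []      x = 0#
  eval (a ∷ f) x = a + x * eval f x

  monic : List Carrier → Poly
  monic lower = lower ++ [ 1# ]

module PowerSeries (R : RawRing c ℓ) where
  open RingOps R

  Series : Set c
  Series = ℕ → Carrier

  const : Carrier → Series
  const a zero    = a
  const a (suc n) = 0#

  seriesRing : RawRing c ℓ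
  seriesRing = record
    { Carrier = Series
    ; _≈_     = λ f g → ∀ n → f n ≈ g n
    ; _+_     = λ f g n → f n + g n
    ; _*_     = λ f g n → ∑[ k < suc n ] (f k * g (n ∸ k))
    ; -_      = λ f n → - f n
    ; 0#      = λ _ → 0#
    ; 1#      = const 1#
    }

  -- quotientRev f g u n lists the coefficients n-1, …, 0 of f / g, where
  -- u is the inverse of the constant term of g; they are obtained by
  -- solving g · q = f one coefficient at a time.
  quotientRev : Series → Series → Carrier → (n : ℕ) → Vec Carrier n
  quotientRev f g u zero    = []
  quotientRev f g u (suc n) = u * (f n - sum (λ i → lookup q i * g (suc (toℕ i)))) ∷ q
    where
    q : Vec Carrier n
    q = quotientRev f g u n

  quotient : (f g : Series) (u : Carrier) → u * g 0 ≈ 1# → Series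
  quotient f g u _ n = head (quotientRev f g u (suc n))

-- Exponentials over a ring containing ℚ, embedded by ι.
module Exponential (R : RawRing c ℓ) (ι : ℚ → RawRing.Carrier R) where
  open RingOps R
  open PowerSeries R

  1/_! : ℕ → ℚ
  1/ n ! = (+ 1 ℚ./ (n !)) {{ n !≢0 }}

  -- exp y is the series e^{yt} in t
  exp : Carrier → Series
  exp y n = ι (1/ n !) * y ^ n

------------------------------------------------------------------------
-- Valued fields

fieldRing : HeytingField c ℓ₁ ℓ₂ → CommutativeRing c ℓ₁
fieldRing F = HeytingCommutativeRing.commutativeRing (HeytingField.heytingCommutativeRing F)

fieldRawRing : HeytingField c ℓ₁ ℓ₂ → RawRing c ℓ₁
fieldRawRing F = CommutativeRing.rawRing (fieldRing F)

IsFieldHomomorphism : (F : HeytingField c ℓ₁ ℓ₂) (G : HeytingField c′ ℓ₁′ ℓ₂′) →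
                      (HeytingField.Carrier F → HeytingField.Carrier G) → Set _
IsFieldHomomorphism F G = IsRingHomomorphism (fieldRawRing F) (fieldRawRing G)

-- Additive valuations |x| = p^{-v(x)}. All fields considered here have
-- their values in ℚ; v(0) = ∞ is avoided by defining v on x # 0 only.
record Valuation (F : HeytingField c ℓ₁ ℓ₂) : Set (c ⊔ ℓ₁ ⊔ ℓ₂) where
  open HeytingField F
  field
    v      : ∀ x → x # 0# → ℚ
    v-cong : ∀ {x y} (x# : x # 0#) (y# : y # 0#) → x ≈ y → v x x# ≡ v y y#
    v-*    : ∀ {x y} (x# : x # 0#) (y# : y # 0#) (xy# : (x * y) # 0#) →
             v (x * y) xy# ≡ v x x# ℚ.+ v y y#
    v-+    : ∀ {x y} (x# : x # 0#) (y# : y # 0#) (x+y# : (x + y) # 0#) →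
             v x x# ℚ.⊓ v y y# ℚ.≤ v (x + y) x+y#

  -- v(x) ≥ r, which holds for every r when x = 0
  infix 4 v[_]≥_
  v[_]≥_ : Carrier → ℚ → Set ℓ₂
  v[ x ]≥ r = (x# : x # 0#) → r ℚ.≤ v x x#

  IsCauchy : (ℕ → Carrier) → Set ℓ₂
  IsCauchy s = ∀ r → ∃[ N ] (∀ m n → N ℕ.≤ m → N ℕ.≤ n → v[ s m - s n ]≥ r)

  _⟶_ : (ℕ → Carrier) → Carrier → Set ℓ₂
  s ⟶ x = ∀ r → ∃[ N ] (∀ n → N ℕ.≤ n → v[ s n - x ]≥ r)

  Complete : Set (c ⊔ ℓ₂)
  Complete = ∀ s → IsCauchy s → ∃[ x ] (s ⟶ x)

Extends : {F : HeytingField c ℓ₁ ℓ₂} {G : HeytingField c′ ℓ₁′ ℓ₂′} →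
          Valuation F → Valuation G →
          (HeytingField.Carrier F → HeytingField.Carrier G) → Set _
Extends {F = F} {G = G} V W ι =
  ∀ x (x# : x F.# F.0#) (ιx# : ι x G.# G.0#) → W.v (ι x) ιx# ≡ V.v x x#
  where
  module F = HeytingField F
  module G = HeytingField G
  module V = Valuation V
  module W = Valuation W

record IsCompletion {F : HeytingField c ℓ₁ ℓ₂} {G : HeytingField c′ ℓ₁′ ℓ₂′}
                    (V : Valuation F) (W : Valuation G)
                    (ι : HeytingField.Carrier F → HeytingField.Carrier G) :
                    Set (c ⊔ ℓ₁ ⊔ ℓ₂ ⊔ c′ ⊔ ℓ₁′ ⊔ ℓ₂′) where
  private
    module F = HeytingField F
    module G = HeytingField G
    module W = Valuation W
  field
    isHomomorphism : IsFieldHomomorphism F G ι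
    extends        : Extends V W ι
    dense          : ∀ y r → ∃[ x ] (W.v[ y G.- ι x ]≥ r)
    complete       : W.Complete

record IsAlgebraicClosure (F : HeytingField c ℓ₁ ℓ₂) (G : HeytingField c′ ℓ₁′ ℓ₂′)
                          (ι : HeytingField.Carrier F → HeytingField.Carrier G) :
                          Set (c ⊔ ℓ₁ ⊔ c′ ⊔ ℓ₁′) where
  private
    module F = HeytingField F
    module G = HeytingField G
    module F[X] = Polynomials (fieldRawRing F)
    module G[X] = Polynomials (fieldRawRing G)
  field
    isHomomorphism : IsFieldHomomorphism F G ι
    algebraic      : ∀ y → ∃[ f ] (G[X].eval (map ι (F[X].monic f)) y G.≈ G.0#)
    -- monic (a ∷ f) ranges over the monic polynomials of degree ≥ 1
    closed         : ∀ a f → ∃[ y ] (G[X].eval (G[X].monic (a ∷ f)) y G.≈ G.0#)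

-- By multiplicativity these values determine v on all of ℚ.
record IsPAdicValuation (p : ℕ) (V : Valuation ℚ.heytingField) : Set where
  open Valuation V
  field
    v-prime : ∀ p# → v (+ p ℚ./ 1) p# ≡ 1ℚ
    v-unit  : ∀ m → ¬ (p ∣ m) → ∀ m# → v (+ m ℚ./ 1) m# ≡ 0ℚ

-- The tower ℚ ⊂ ℚₚ ⊂ ℚ̄ₚ ⊂ ℂₚ together with an algebraic closure ℚ̄ of ℚ
-- and an embedding of ℚ̄ into ℂₚ. None of these fields is constructed;
-- each is specified by its defining property.
record PAdicFields (p : ℕ) (c ℓ₁ ℓ₂ : Level) : Set (lsuc (c ⊔ ℓ₁ ⊔ ℓ₂)) where
  field
    vℚ           : Valuation ℚ.heytingField
    vℚ-isPAdic   : IsPAdicValuation p vℚ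

    ℚₚ           : HeytingField c ℓ₁ ℓ₂
    vₚ           : Valuation ℚₚ
    ℚ→ℚₚ         : ℚ → HeytingField.Carrier ℚₚ
    isCompletion : IsCompletion vℚ vₚ ℚ→ℚₚ

    ℚ̄ₚ           : HeytingField c ℓ₁ ℓ₂
    v̄ₚ           : Valuation ℚ̄ₚ
    ℚₚ→ℚ̄ₚ        : HeytingField.Carrier ℚₚ → HeytingField.Carrier ℚ̄ₚ
    isClosureₚ   : IsAlgebraicClosure ℚₚ ℚ̄ₚ ℚₚ→ℚ̄ₚ
    v̄ₚ-extends   : Extends vₚ v̄ₚ ℚₚ→ℚ̄ₚ

    ℂₚ            : HeytingField c ℓ₁ ℓ₂
    vℂ            : Valuation ℂₚ
    ℚ̄ₚ→ℂₚ         : HeytingField.Carrier ℚ̄ₚ → HeytingField.Carrier ℂₚ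
    isCompletionℂ : IsCompletion v̄ₚ vℂ ℚ̄ₚ→ℂₚ

    ℚ̄              : HeytingField c ℓ₁ ℓ₂
    ℚ→ℚ̄            : ℚ → HeytingField.Carrier ℚ̄
    isClosure      : IsAlgebraicClosure ℚ.heytingField ℚ̄ ℚ→ℚ̄
    ℚ̄→ℂₚ           : HeytingField.Carrier ℚ̄ → HeytingField.Carrier ℂₚ
    isEmbedding    : IsFieldHomomorphism ℚ̄ ℂₚ ℚ̄→ℂₚ

  ∣ℚₚ∣ ∣ℂₚ∣ : Set c
  ∣ℚₚ∣ = HeytingField.Carrier ℚₚ
  ∣ℂₚ∣ = HeytingField.Carrier ℂₚ

  _∈ℤₚ : ∣ℚₚ∣ → Set ℓ₂
  y ∈ℤₚ = v[ y ]≥ 0ℚ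
    where open Valuation vₚ

  ℚₚ→ℂₚ : ∣ℚₚ∣ → ∣ℂₚ∣
  ℚₚ→ℂₚ y = ℚ̄ₚ→ℂₚ (ℚₚ→ℚ̄ₚ y)

  ℚ→ℂₚ : ℚ → ∣ℂₚ∣
  ℚ→ℂₚ q = ℚₚ→ℂₚ (ℚ→ℚₚ q)

------------------------------------------------------------------------
-- Dirichlet characters

-- A Dirichlet character modulo d, extended by zero to all of ℤ.
record DirichletCharacter (R : RawRing c ℓ) (d : ℕ) : Set (c ⊔ ℓ) where
  open RawRing R
  field
    χ          : ℤ → Carrier
    χ-*        : ∀ a b → χ (a ℤ.* b) ≈ χ a * χ b
    χ-1        : χ (+ 1) ≈ 1#
    χ-periodic : ∀ a → χ (a ℤ.+ + d) ≈ χ a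
    χ-zero     : ∀ a → ¬ ℤ.Coprime a (+ d) → χ a ≈ 0#

  -- χ does not factor through a proper divisor e of d
  Primitive : Set ℓ
  Primitive = ∀ e → e ∣ d →
    (∀ a b → ℤ.Coprime a (+ d) → ℤ.Coprime b (+ d) → + e ℤ.∣ a ℤ.- b → χ a ≈ χ b) →
    e ≡ d

------------------------------------------------------------------------
-- Generalized Euler polynomials and alternating power sums, for a
-- K-valued function χ on ℕ, K being a ring containing ℚ.

module GeneralizedEuler
  (K : CommutativeRing c ℓ) (ι : ℚ → CommutativeRing.Carrier K)
  (ι-hom : IsRingHomomorphism ℚ.+-*-rawRing (CommutativeRing.rawRing K) ι)
  (d : ℕ) (χ : ℕ → CommutativeRing.Carrier K) where

  private
    K₀ : RawRing _ _
    K₀ = CommutativeRing.rawRing K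

  open Polynomials K₀ public using (Poly; polyRing; X; eval)

  module Generating where
    open Exponential polyRing (λ q → [ ι q ]) public
    open PowerSeries polyRing public
    open RingOps seriesRing
    private module K[x] = RingOps polyRing

    numerator : Series
    numerator = fromℕ 2 * exp X *
      (∑[ a < d ] ((- 1#) ^ a * const [ χ a ] * exp (K[x].fromℕ a)))

    denominator : Series
    denominator = exp (K[x].fromℕ d) + 1#

    -- the constant term of the denominator is 2
    ½-inverse : [ ι ½ ] K[x].* denominator 0 K[x].≈ K[x].1#
    ½-inverse (suc i) = CommutativeRing.refl K
    ½-inverse zero    = begin
      ι ½ · (ι 1ℚ · 1ₖ +ₖ 0ₖ +ₖ 1ₖ) +ₖ 0ₖ  ≈⟨ +-identityʳ _ ⟩
      ι ½ · (ι 1ℚ · 1ₖ +ₖ 0ₖ +ₖ 1ₖ)        ≈⟨ *-congˡ (+-congʳ (trans (+-identityʳ _) (*-identityʳ _))) ⟩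
      ι ½ · (ι 1ℚ +ₖ 1ₖ)                   ≈⟨ *-congˡ (+-congˡ 1#-homo) ⟨
      ι ½ · (ι 1ℚ +ₖ ι 1ℚ)                 ≈⟨ *-congˡ (+-homo 1ℚ 1ℚ) ⟨
      ι ½ · ι (1ℚ ℚ.+ 1ℚ)                  ≈⟨ *-homo ½ (1ℚ ℚ.+ 1ℚ) ⟨
      ι 1ℚ                                 ≈⟨ 1#-homo ⟩
      1ₖ                                   ∎
      where
      open CommutativeRing K using (setoid; trans; +-identityʳ; *-identityʳ; *-congˡ; +-congʳ; +-congˡ)
        renaming (_+_ to infixl 6 _+ₖ_; _*_ to infixl 7 _·_; 0# to 0ₖ; 1# to 1ₖ)
      open IsRingHomomorphism ι-hom
      open import Relation.Binary.Reasoning.Setoid setoid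

    generatingFunction : Series
    generatingFunction = quotient numerator denominator [ ι ½ ] ½-inverse

  -- n! times the coefficient of t^n, as a polynomial in x
  E : ℕ → Poly
  E n = fromℕ (n !) * Generating.generatingFunction n
    where open RingOps polyRing

  open RingOps K₀

  -- x ^ 0 is 1# for every x, including 0#
  T : ℕ → ℕ → Carrier
  T k n = ∑[ a < suc n ] ((- 1#) ^ a * χ a * fromℕ a ^ k)

  expression : ℕ → Carrier → (u v w : ℕ) .{{_ : NonZero u}} → Carrier
  expression n y u v w =
    fromℕ u ^ n *
    (∑[ k < suc n ] (fromℕ (n C k) *
      (∑[ a < u ℕ.* d ] ((- 1#) ^ a * χ a *
          eval (E k) (fromℕ v * y + ι (+ v ℚ./ u) * fromℕ a))) *
      T (n ∸ k) (w ℕ.* d ∸ 1) * fromℕ v ^ (n ∸ k) * fromℕ w ^ k))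

module _ {p : ℕ} (S : PAdicFields p c ℓ₁ ℓ₂) where
  open PAdicFields S

  ℚ→ℂₚ-hom : IsRingHomomorphism ℚ.+-*-rawRing (fieldRawRing ℂₚ) ℚ→ℂₚ
  ℚ→ℂₚ-hom = isRingHomomorphism ℂ.trans (isRingHomomorphism ℚ̄.trans
      (IsCompletion.isHomomorphism isCompletion)
      (IsAlgebraicClosure.isHomomorphism isClosureₚ))
      (IsCompletion.isHomomorphism isCompletionℂ)
    where
    open import Algebra.Morphism.Construct.Composition using (isRingHomomorphism)
    module ℂ = CommutativeRing (fieldRing ℂₚ)
    module ℚ̄ = CommutativeRing (fieldRing ℚ̄ₚ)

  module EulerFor {d : ℕ} (χ : DirichletCharacter (fieldRawRing ℚ̄) d) =
    GeneralizedEuler (fieldRing ℂₚ) ℚ→ℂₚ ℚ→ℂₚ-hom d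
      (λ a → ℚ̄→ℂₚ (DirichletCharacter.χ χ (+ a)))

{-# OPTIONS --safe #-}

-- Put A(t) = ∑_{a<d} (-1)ᵃ χ(a) eᵃᵗ and D(t) = eᵈᵗ + 1, so that E_{n,χ}(x) has exponential generating
-- function 2 eˣᵗ A(t) / D(t). For odd u, antiperiodicity of (-1)ᵃ χ(a) and a geometric sum give
-- ∑_{a<ud} (-1)ᵃ χ(a) eᵃᵗ = A(t) D(ut) / D(t). Hence the expression with parameters u, v, w has
-- exponential generating function
--   2 e^{uvwyt} A(uwt) A(vwt) A(uvt) D(uvwt)² / (D(uwt) D(vwt) D(uvt)),
-- which is symmetric in u, v, w. Instead of dividing, we cancel D, whose constant term 2 is invertible.
module Submission where

open import Defs
open import Level using (Level)
open import Algebra.Apartness.Bundles using (HeytingField)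
open import Algebra.Bundles using (CommutativeRing)
open import Algebra.Bundles.Raw using (RawRing)
import Algebra.Construct.Pointwise as Pointwise
open import Algebra.Morphism.Structures using (IsRingHomomorphism)
import Algebra.Properties.AbelianGroup as AbelianGroupProperties
import Algebra.Properties.CommutativeMonoid.Sum as CommutativeMonoidSumProperties
import Algebra.Properties.CommutativeSemigroup as CommutativeSemigroupProperties
import Algebra.Properties.CommutativeSemiring.Exp as ExpProperties
import Algebra.Properties.Group as GroupProperties
import Algebra.Properties.Ring as RingProperties
import Algebra.Properties.Semiring.Mult as MultProperties
import Algebra.Properties.Semiring.Sum as SumProperties
import Algebra.Solver.Ring.NaturalCoefficients.Default as Solver
open import Data.Empty using (⊥-elim)
open import Data.Fin.Base using (Fin; zero; suc; toℕ)
open import Data.Fin.Properties using (toℕ<n)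
open import Data.Integer.Base as ℤ using (+_)
import Data.Integer.Properties as ℤ
open import Data.List.Base using ([]; _∷_; [_]; map)
open import Data.Nat.Base as ℕ using (ℕ; NonZero; zero; suc; _∸_; _!; _<_; _≤_; s≤s; s≤s⁻¹)
open import Data.Nat.Combinatorics
  using (_C_; nCk+nC[k+1]≡[n+1]C[k+1]; k>n⇒nCk≡0; nCk≡n!/k![n-k]!; k![n∸k]!∣n!)
open import Data.Nat.Divisibility using (∣m∣n⇒∣m+n; ∣-refl; _∣0)
open import Data.Nat.DivMod using (m/n*n≡m)
open import Data.Nat.Primality using (Prime)
import Data.Nat.Properties as ℕ
open import Data.Product.Base using (_×_; _,_)
open import Data.Rational.Base as ℚ using (ℚ; ½; 1ℚ; toℚᵘ)
import Data.Rational.Properties as ℚ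
import Data.Rational.Unnormalised.Base as ℚᵘ
import Data.Rational.Unnormalised.Properties as ℚᵘ
open import Data.Vec.Base using (lookup)
open import Relation.Binary.PropositionalEquality.Core as ≡ using (_≡_)
import Relation.Binary.Reasoning.Setoid as SetoidReasoning

-- The obstacle is that `E` is defined by a quotient of power series over list polynomials, where
-- only raw operations are at hand. No algebra is done there. Evaluation at a point of `K` is a
-- homomorphism out of these raw rings, and it carries everything to exponential generating
-- functions over `K`, which do form a commutative ring, so that the ring solver applies. How the
-- three factors arise: under t ↦ uwt the argument vy + (v/u)a of the Euler polynomials becomes the
-- exponent uvwy + vwa. The denominator u disappears, and the sum over a becomes an alternating
-- power sum of length ud at vwt. The other factor is the power sum of length wd at uvt. Reducing
-- either sum to length d leaves the same factor D(uvwt), since u · vw = w · uv; hence the square.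

private
  variable
    c ℓ c′ ℓ′ : Level

-- Odd numbers, finite sums and signs in a commutative ring.

odd⇒nonZero : ∀ {n} → Odd n → NonZero n
odd⇒nonZero {zero}  odd = ⊥-elim (odd (2 ∣0))
odd⇒nonZero {suc n} odd = _

odd-drop₂ : ∀ {n} → Odd (suc (suc n)) → Odd n
odd-drop₂ odd 2∣n = odd (∣m∣n⇒∣m+n ∣-refl 2∣n)

module RingLemmas (R : CommutativeRing c ℓ) where
  open CommutativeRing R
  open RingOps rawRing using (∑; fromℕ; _^_)
  open SetoidReasoning setoid
  open SumProperties semiring using (sum-cong-≋; *-distribˡ-sum; *-distribʳ-sum)
  open RingProperties ring using (-‿distribˡ-*; -‿distribʳ-*)
  open GroupProperties +-group using (⁻¹-involutive)

  ∑-cong : ∀ n {f g} → (∀ k → k < n → f k ≈ g k) → ∑ n f ≈ ∑ n g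
  ∑-cong n f≈g = sum-cong-≋ {n} (λ i → f≈g (toℕ i) (toℕ<n i))

  ∑-distribˡ : ∀ n x f → x * ∑ n f ≈ ∑[ k < n ] (x * f k)
  ∑-distribˡ n x f = *-distribˡ-sum {n} x (λ i → f (toℕ i))

  ∑-distribʳ : ∀ n x f → ∑ n f * x ≈ ∑[ k < n ] (f k * x)
  ∑-distribʳ n x f = *-distribʳ-sum {n} x (λ i → f (toℕ i))

  ∑-distrib-+ : ∀ n f g → ∑[ k < n ] (f k + g k) ≈ ∑ n f + ∑ n g
  ∑-distrib-+ n f g = CommutativeMonoidSumProperties.∑-distrib-+ +-commutativeMonoid {n}
    (λ i → f (toℕ i)) (λ i → g (toℕ i))

  ∑-++ : ∀ m n f → ∑ (m ℕ.+ n) f ≈ ∑ m f + ∑[ k < n ] f (m ℕ.+ k)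
  ∑-++ zero    n f = sym (+-identityˡ _)
  ∑-++ (suc m) n f = begin
    f 0 + ∑ (m ℕ.+ n) (λ k → f (suc k))                        ≈⟨ +-congˡ (∑-++ m n (λ k → f (suc k))) ⟩
    f 0 + (∑[ k < m ] f (suc k) + ∑[ k < n ] f (suc m ℕ.+ k))  ≈⟨ +-assoc _ _ _ ⟨
    ∑ (suc m) f + ∑[ k < n ] f (suc m ℕ.+ k)                   ∎

  ∑-last : ∀ n f → ∑ (suc n) f ≈ ∑ n f + f n
  ∑-last zero    f = +-comm _ _
  ∑-last (suc n) f = trans (+-congˡ (∑-last n (λ k → f (suc k)))) (sym (+-assoc _ _ _))

  -x*-y≈x*y : ∀ x y → (- x) * (- y) ≈ x * y
  -x*-y≈x*y x y = begin
    (- x) * (- y)  ≈⟨ -‿distribˡ-* x (- y) ⟨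
    - (x * - y)    ≈⟨ -‿cong (-‿distribʳ-* x y) ⟨
    - - (x * y)    ≈⟨ ⁻¹-involutive _ ⟩
    x * y          ∎

  -- Oddness survives subtracting 2, and two factors `- x` multiply to `x * x`, so the recursion
  -- descends in steps of two to the exponent 1.
  odd-^ : ∀ {n} → Odd n → ∀ x → (- x) ^ n ≈ - (x ^ n)
  odd-^ {zero}        odd x = ⊥-elim (odd (2 ∣0))
  odd-^ {suc zero}    odd x = sym (-‿distribˡ-* x 1#)
  odd-^ {suc (suc n)} odd x = begin
    - x * (- x * (- x) ^ n)  ≈⟨ *-assoc _ _ _ ⟨
    - x * - x * (- x) ^ n    ≈⟨ *-cong (-x*-y≈x*y x x) (odd-^ (odd-drop₂ odd) x) ⟩
    x * x * - (x ^ n)        ≈⟨ -‿distribʳ-* _ _ ⟨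
    - (x * x * x ^ n)        ≈⟨ -‿cong (*-assoc _ _ _) ⟩
    - (x * (x * x ^ n))      ∎

  binomial-factorials : ∀ {n k} → k ≤ n →
    fromℕ (n !) ≈ fromℕ (n C k) * (fromℕ (k !) * fromℕ ((n ∸ k) !))
  binomial-factorials {n} {k} k≤n = begin
    fromℕ (n !)                                         ≡⟨ ≡.cong fromℕ nat ⟨
    fromℕ ((n C k) ℕ.* (k ! ℕ.* (n ∸ k) !))               ≈⟨ ×1-homo-* (n C k) _ ⟩
    fromℕ (n C k) * fromℕ (k ! ℕ.* (n ∸ k) !)           ≈⟨ *-congˡ (×1-homo-* (k !) _) ⟩
    fromℕ (n C k) * (fromℕ (k !) * fromℕ ((n ∸ k) !))   ∎
    where
    open MultProperties semiring using (×1-homo-*)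
    instance
      _ = k ℕ.!* (n ∸ k) !≢0
    nat : (n C k) ℕ.* (k ! ℕ.* (n ∸ k) !) ≡ n !
    nat = ≡.trans (≡.cong (ℕ._* (k ! ℕ.* (n ∸ k) !)) (nCk≡n!/k![n-k]! k≤n)) (m/n*n≡m (k![n∸k]!∣n! k≤n))

-- Homomorphisms from a raw ring to a commutative ring, and quotients of power series.

module HomomorphismLemmas {R : RawRing c ℓ} (S : CommutativeRing c′ ℓ′)
  {φ : RawRing.Carrier R → CommutativeRing.Carrier S}
  (φ-hom : IsRingHomomorphism R (CommutativeRing.rawRing S) φ) where
  open CommutativeRing S
  open IsRingHomomorphism φ-hom
  open SetoidReasoning setoid
  open SumProperties semiring using (sum-cong-≋)
  open GroupProperties +-group using (//-rightDividesˡ)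
  open PowerSeries R using (quotientRev; quotient)
  private
    module R = RingOps R
    module S = RingOps rawRing

  homo-sum : ∀ {n} (t : Fin n → R.Carrier) → φ (R.sum t) ≈ S.sum (λ i → φ (t i))
  homo-sum {zero}  t = 0#-homo
  homo-sum {suc n} t = trans (+-homo _ _) (+-congˡ (homo-sum (λ i → t (suc i))))

  homo-∑ : ∀ n f → φ (R.∑ n f) ≈ S.∑[ k < n ] φ (f k)
  homo-∑ n f = homo-sum {n} (λ i → f (toℕ i))

  homo-^ : ∀ x n → φ (x R.^ n) ≈ φ x S.^ n
  homo-^ x zero    = 1#-homo
  homo-^ x (suc n) = trans (*-homo _ _) (*-congˡ (homo-^ x n))

  homo-fromℕ : ∀ n → φ (R.fromℕ n) ≈ S.fromℕ n
  homo-fromℕ zero    = 0#-homo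
  homo-fromℕ (suc n) = trans (+-homo _ _) (+-cong 1#-homo (homo-fromℕ n))

  -- Every tail of `quotientRev` is again a `quotientRev`, for a smaller length; after dropping i
  -- entries the head is the coefficient of index n - 1 - i.
  lookup-quotientRev : ∀ f g u (u*g₀≈1 : u R.* g 0 R.≈ R.1#) n (i : Fin n) →
    lookup (quotientRev f g u n) i ≡ quotient f g u u*g₀≈1 (n ∸ suc (toℕ i))
  lookup-quotientRev f g u u*g₀≈1 (suc n) zero    = ≡.refl
  lookup-quotientRev f g u u*g₀≈1 (suc n) (suc i) = lookup-quotientRev f g u u*g₀≈1 n i

  -- The recursion defining the quotient is g · q = f solved for its newest coefficient. Undoing it
  -- takes ring laws, which are available only in `S`; hence the equation is stated after applying
  -- `φ`.
  homo-quotient : ∀ f g u (u*g₀≈1 : u R.* g 0 R.≈ R.1#) n →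
    S.∑[ k < suc n ] (φ (g k) * φ (quotient f g u u*g₀≈1 (n ∸ k))) ≈ φ (f n)
  homo-quotient f g u u*g₀≈1 n = begin
    φ (g 0) * φ (q n) + s                ≈⟨ +-congʳ (*-congˡ (trans (*-homo _ _) (*-congˡ numerator))) ⟩
    φ (g 0) * (φ u * (φ (f n) - s)) + s  ≈⟨ +-congʳ (*-assoc _ _ _) ⟨
    φ (g 0) * φ u * (φ (f n) - s) + s    ≈⟨ +-congʳ (*-congʳ inverse) ⟩
    1# * (φ (f n) - s) + s               ≈⟨ +-congʳ (*-identityˡ _) ⟩
    φ (f n) - s + s                      ≈⟨ //-rightDividesˡ s (φ (f n)) ⟩
    φ (f n)                              ∎
    where
    q : ℕ → R.Carrier
    q = quotient f g u u*g₀≈1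
    s : Carrier
    s = S.∑[ k < n ] (φ (g (suc k)) * φ (q (n ∸ suc k)))
    inverse : φ (g 0) * φ u ≈ 1#
    inverse = trans (*-comm _ _) (trans (sym (*-homo _ _)) (trans (⟦⟧-cong u*g₀≈1) 1#-homo))
    numerator : φ (f n R.- R.sum (λ i → lookup (quotientRev f g u n) i R.* g (suc (toℕ i)))) ≈ φ (f n) - s
    numerator = trans (+-homo _ _) (+-congˡ (trans (-‿homo _) (-‿cong (trans
      (homo-sum {n} (λ i → lookup (quotientRev f g u n) i R.* g (suc (toℕ i))))
      (sum-cong-≋ {n} (λ i → trans (*-homo _ _) (trans (*-comm _ _)
        (*-congˡ {φ (g (suc (toℕ i)))} (reflexive (≡.cong φ (lookup-quotientRev f g u u*g₀≈1 n i)))))))))))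

-- Exponential generating functions (Hurwitz series): f stands for ∑ f n tⁿ / n!.
-- Differentiation is the shift, so the product is determined by the Leibniz rule.
module Hurwitz (K : CommutativeRing c ℓ) where
  open CommutativeRing K
  open RingOps rawRing using (∑; fromℕ; _^_)
  open PowerSeries rawRing using (Series; const; seriesRing)
  open RingLemmas K
  open SetoidReasoning setoid
  open Solver commutativeSemiring
  open CommutativeSemigroupProperties +-commutativeSemigroup using (interchange)
  open ExpProperties commutativeSemiring using (^-distrib-*; ^-congˡ)

  -- Differentiation with respect to t. The denominator eᵈᵗ + 1, written D(t) in the overview, is
  -- `den` below.
  D : Series → Series
  D f n = f (suc n)

  infix 4 _≋_
  _≋_ : Series → Series → Set ℓ
  f ≋ g = ∀ n → f n ≈ g n

  infixl 7 _⊛_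
  _⊛_ : Series → Series → Series
  (f ⊛ g) zero    = f 0 * g 0
  (f ⊛ g) (suc n) = (D f ⊛ g) n + (f ⊛ D g) n

  ⊛-cong : ∀ {f f′ g g′} → f ≋ f′ → g ≋ g′ → f ⊛ g ≋ f′ ⊛ g′
  ⊛-cong p q zero    = *-cong (p 0) (q 0)
  ⊛-cong p q (suc n) = +-cong (⊛-cong (λ k → p (suc k)) q n) (⊛-cong p (λ k → q (suc k)) n)

  ⊛-comm : ∀ f g → f ⊛ g ≋ g ⊛ f
  ⊛-comm f g zero    = *-comm _ _
  ⊛-comm f g (suc n) = trans (+-comm _ _) (+-cong (⊛-comm f (D g) n) (⊛-comm (D f) g n))

  ⊛-distribˡ : ∀ f g h → f ⊛ (λ n → g n + h n) ≋ (λ n → (f ⊛ g) n + (f ⊛ h) n)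
  ⊛-distribˡ f g h zero    = distribˡ _ _ _
  ⊛-distribˡ f g h (suc n) =
    trans (+-cong (⊛-distribˡ (D f) g h n) (⊛-distribˡ f (D g) (D h) n)) (interchange _ _ _ _)

  ⊛-distribʳ : ∀ f g h → (λ n → g n + h n) ⊛ f ≋ (λ n → (g ⊛ f) n + (h ⊛ f) n)
  ⊛-distribʳ f g h n = trans (⊛-comm _ f n)
    (trans (⊛-distribˡ f g h n) (+-cong (⊛-comm f g n) (⊛-comm f h n)))

  ⊛-scaleˡ : ∀ a f g → (λ n → a * f n) ⊛ g ≋ (λ n → a * (f ⊛ g) n)
  ⊛-scaleˡ a f g zero    = *-assoc _ _ _
  ⊛-scaleˡ a f g (suc n) = trans (+-cong (⊛-scaleˡ a (D f) g n) (⊛-scaleˡ a f (D g) n)) (sym (distribˡ _ _ _))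

  ⊛-scaleʳ : ∀ a f g → f ⊛ (λ n → a * g n) ≋ (λ n → a * (f ⊛ g) n)
  ⊛-scaleʳ a f g n = trans (⊛-comm f _ n) (trans (⊛-scaleˡ a g f n) (*-congˡ (⊛-comm g f n)))

  -- Differentiating either side by the Leibniz rule gives the same three terms, with `D` on `f`, on
  -- `g` or on `h`.
  ⊛-assoc : ∀ f g h → (f ⊛ g) ⊛ h ≋ f ⊛ (g ⊛ h)
  ⊛-assoc f g h zero    = *-assoc _ _ _
  ⊛-assoc f g h (suc n) = begin
    (D (f ⊛ g) ⊛ h) n + ((f ⊛ g) ⊛ D h) n
      ≈⟨ +-congʳ (⊛-distribʳ h (D f ⊛ g) (f ⊛ D g) n) ⟩
    ((D f ⊛ g) ⊛ h) n + ((f ⊛ D g) ⊛ h) n + ((f ⊛ g) ⊛ D h) n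
      ≈⟨ +-cong (+-cong (⊛-assoc (D f) g h n) (⊛-assoc f (D g) h n)) (⊛-assoc f g (D h) n) ⟩
    (D f ⊛ (g ⊛ h)) n + (f ⊛ (D g ⊛ h)) n + (f ⊛ (g ⊛ D h)) n
      ≈⟨ +-assoc _ _ _ ⟩
    (D f ⊛ (g ⊛ h)) n + ((f ⊛ (D g ⊛ h)) n + (f ⊛ (g ⊛ D h)) n)
      ≈⟨ +-congˡ (⊛-distribˡ f (D g ⊛ h) (g ⊛ D h) n) ⟨
    (D f ⊛ (g ⊛ h)) n + (f ⊛ D (g ⊛ h)) n
      ∎

  ⊛-zeroˡ : ∀ f → (λ _ → 0#) ⊛ f ≋ (λ _ → 0#)
  ⊛-zeroˡ f n = trans (⊛-cong (λ _ → sym (zeroˡ 0#)) (λ _ → refl) n) (trans (⊛-scaleˡ 0# (λ _ → 0#) f n) (zeroˡ _))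

  const-⊛ : ∀ a f → const a ⊛ f ≋ (λ n → a * f n)
  const-⊛ a f zero    = refl
  const-⊛ a f (suc n) = trans (+-cong (⊛-zeroˡ f n) (const-⊛ a (D f) n)) (+-identityˡ _)

  ⊛-identityˡ : ∀ f → const 1# ⊛ f ≋ f
  ⊛-identityˡ f n = trans (const-⊛ 1# f n) (*-identityˡ _)

  commutativeRing : CommutativeRing c ℓ
  commutativeRing = record
    { Carrier           = Series
    ; _≈_               = _≋_
    ; _+_               = λ f g n → f n + g n
    ; _*_               = _⊛_
    ; -_                = λ f n → - f n
    ; 0#                = λ _ → 0#
    ; 1#                = const 1#
    ; isCommutativeRing = record
      { isRing = record
        { +-isAbelianGroup = Pointwise.isAbelianGroup ℕ +-isAbelianGroup
        ; *-cong           = ⊛-cong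
        ; *-assoc          = ⊛-assoc
        ; *-identity       = ⊛-identityˡ , λ f n → trans (⊛-comm f (const 1#) n) (⊛-identityˡ f n)
        ; distrib          = ⊛-distribˡ , ⊛-distribʳ
        }
      ; *-comm = ⊛-comm
      }
    }

  module H = CommutativeRing commutativeRing
  module HOps = RingOps H.rawRing
  module HLemmas = RingLemmas commutativeRing

  ∑-pointwise : ∀ m (f : ℕ → Series) n → HOps.∑ m f n ≈ ∑[ k < m ] f k n
  ∑-pointwise zero    f n = refl
  ∑-pointwise (suc m) f n = +-congˡ (∑-pointwise m (λ k → f (suc k)) n)

  const-cong : ∀ {a b} → a ≈ b → const a ≋ const b
  const-cong a≈b zero    = a≈b
  const-cong a≈b (suc n) = refl

  const-isRingHomomorphism : IsRingHomomorphism rawRing H.rawRing const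
  const-isRingHomomorphism = record
    { isSemiringHomomorphism = record
      { isNearSemiringHomomorphism = record
        { +-isMonoidHomomorphism = record
          { isMagmaHomomorphism = record
            { isRelHomomorphism = record { cong = const-cong }
            ; homo = λ _ _ → λ { zero → refl ; (suc n) → sym (+-identityʳ _) }
            }
          ; ε-homo = λ { zero → refl ; (suc n) → refl }
          }
        ; *-homo = λ a b n → sym (trans (const-⊛ a (const b) n) (const-const a b n))
        }
      ; 1#-homo = λ _ → refl
      }
    ; -‿homo = λ _ → λ { zero → refl ; (suc n) → sym -0#≈0# }
    }
    where
    open RingProperties ring using (-0#≈0#)
    const-const : ∀ a b n → a * const b n ≈ const (a * b) n
    const-const a b zero    = refl
    const-const a b (suc n) = zeroʳ a

  -- Links the Leibniz product to the binomial sums in `expression`; the inductive step is Pascal's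
  -- rule.
  ⊛-binomial : ∀ f g n → (f ⊛ g) n ≈ ∑[ k < suc n ] (fromℕ (n C k) * (f k * g (n ∸ k)))
  ⊛-binomial f g zero = solve 1 (λ x → x := (con 1 :+ con 0) :* x :+ con 0) refl (f 0 * g 0)
  ⊛-binomial f g (suc n) = begin
    (D f ⊛ g) n + (f ⊛ D g) n
      ≈⟨ +-cong (⊛-binomial (D f) g n) (⊛-binomial f (D g) n) ⟩
    ∑[ k < suc n ] (B n k * (f (suc k) * g (n ∸ k))) + (b + ∑[ k < n ] (B n (suc k) * (f (suc k) * g (suc (n ∸ suc k)))))
      ≈⟨ +-congˡ (+-congˡ pad) ⟩
    ∑[ k < suc n ] (B n k * (f (suc k) * g (n ∸ k))) + (b + ∑[ k < suc n ] (B n (suc k) * (f (suc k) * g (n ∸ k))))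
      ≈⟨ solve 3 (λ x y z → x :+ (y :+ z) := y :+ (x :+ z)) refl _ _ _ ⟩
    b + (∑[ k < suc n ] (B n k * (f (suc k) * g (n ∸ k))) + ∑[ k < suc n ] (B n (suc k) * (f (suc k) * g (n ∸ k))))
      ≈⟨ +-congˡ (∑-distrib-+ (suc n) (λ k → B n k * (f (suc k) * g (n ∸ k)))
                                      (λ k → B n (suc k) * (f (suc k) * g (n ∸ k)))) ⟨
    b + ∑[ k < suc n ] (B n k * (f (suc k) * g (n ∸ k)) + B n (suc k) * (f (suc k) * g (n ∸ k)))
      ≈⟨ +-congˡ (∑-cong (suc n) (λ k _ → trans (sym (distribʳ (f (suc k) * g (n ∸ k)) _ _)) (*-congʳ (pascal k)))) ⟩
    b + ∑[ k < suc n ] (B (suc n) (suc k) * (f (suc k) * g (n ∸ k)))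
      ∎
    where
    open MultProperties semiring using (×-homo-+)
    B : ℕ → ℕ → Carrier
    B n k = fromℕ (n C k)
    b : Carrier
    b = B n 0 * (f 0 * g (suc n))
    pascal : ∀ k → B n k + B n (suc k) ≈ B (suc n) (suc k)
    pascal k = trans (sym (×-homo-+ 1# (n C k) (n C suc k))) (reflexive (≡.cong fromℕ (nCk+nC[k+1]≡[n+1]C[k+1] n k)))
    -- Splitting off k = 0 leaves the sum from `f ⊛ D g` one term shorter than the sum it is to be
    -- added to. The missing term has coefficient n C (n + 1) = 0.
    pad : ∑[ k < n ] (B n (suc k) * (f (suc k) * g (suc (n ∸ suc k)))) ≈
      ∑[ k < suc n ] (B n (suc k) * (f (suc k) * g (n ∸ k)))
    pad = begin
      ∑[ k < n ] (B n (suc k) * (f (suc k) * g (suc (n ∸ suc k))))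
        ≈⟨ ∑-cong n (λ k k<n → *-congˡ {B n (suc k)} (*-congˡ {f (suc k)}
             (reflexive (≡.cong g (≡.sym (ℕ.+-∸-assoc 1 k<n)))))) ⟩
      ∑[ k < n ] (B n (suc k) * (f (suc k) * g (n ∸ k)))
        ≈⟨ +-identityʳ _ ⟨
      ∑[ k < n ] (B n (suc k) * (f (suc k) * g (n ∸ k))) + 0#
        ≈⟨ +-congˡ (trans (*-congʳ (reflexive (≡.cong fromℕ (k>n⇒nCk≡0 (ℕ.n<1+n n))))) (zeroˡ _)) ⟨
      ∑[ k < n ] (B n (suc k) * (f (suc k) * g (n ∸ k))) + B n (suc n) * (f (suc n) * g (n ∸ n))
        ≈⟨ ∑-last n (λ k → B n (suc k) * (f (suc k) * g (n ∸ k))) ⟨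
      ∑[ k < suc n ] (B n (suc k) * (f (suc k) * g (n ∸ k)))
        ∎

  -- The passage from ordinary to exponential generating functions.
  hurwitz : Series → Series
  hurwitz f n = fromℕ (n !) * f n

  -- In each term of the Cauchy product, n! factors as the binomial coefficient times k! and (n -
  -- k)!, one factorial for each series.
  hurwitz-* : ∀ f g → hurwitz (RawRing._*_ seriesRing f g) ≋ hurwitz f ⊛ hurwitz g
  hurwitz-* f g n = begin
    fromℕ (n !) * ∑[ k < suc n ] (f k * g (n ∸ k))
      ≈⟨ ∑-distribˡ (suc n) (fromℕ (n !)) (λ k → f k * g (n ∸ k)) ⟩
    ∑[ k < suc n ] (fromℕ (n !) * (f k * g (n ∸ k)))
      ≈⟨ ∑-cong (suc n) (λ k k<1+n → trans (*-congʳ (binomial-factorials (s≤s⁻¹ k<1+n)))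
           (solve 5 (λ b x y z w → b :* (x :* y) :* (z :* w) := b :* (x :* z :* (y :* w))) refl _ _ _ (f k) (g (n ∸ k)))) ⟩
    ∑[ k < suc n ] (fromℕ (n C k) * (hurwitz f k * hurwitz g (n ∸ k)))
      ≈⟨ ⊛-binomial (hurwitz f) (hurwitz g) n ⟨
    (hurwitz f ⊛ hurwitz g) n
      ∎

  -- The exponential e^(xt): in this normalisation its coefficients are plain powers, free of
  -- factorials.
  e : Carrier → Series
  e x n = x ^ n

  e-cong : ∀ {x y} → x ≈ y → e x ≋ e y
  e-cong x≈y n = ^-congˡ n x≈y

  e-0 : e 0# ≋ const 1#
  e-0 zero    = refl
  e-0 (suc n) = zeroˡ _

  -- Both sides have constant term 1 and are multiplied by x + y under differentiation.
  e-+ : ∀ x y → e (x + y) ≋ e x ⊛ e y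
  e-+ x y zero    = sym (*-identityˡ _)
  e-+ x y (suc n) = begin
    (x + y) * e (x + y) n                                        ≈⟨ *-congˡ (e-+ x y n) ⟩
    (x + y) * (e x ⊛ e y) n                                      ≈⟨ distribʳ _ _ _ ⟩
    x * (e x ⊛ e y) n + y * (e x ⊛ e y) n                        ≈⟨ +-cong (⊛-scaleˡ x (e x) (e y) n)
                                                                           (⊛-scaleʳ y (e x) (e y) n) ⟨
    ((λ k → x * e x k) ⊛ e y) n + (e x ⊛ (λ k → y * e y k)) n    ∎

  -- The substitution t ↦ a t.
  σ : Carrier → Series → Series
  σ a f n = a ^ n * f n

  σ-⊛ : ∀ a f g → σ a (f ⊛ g) ≋ σ a f ⊛ σ a g
  σ-⊛ a f g zero = solve 2 (λ x y → con 1 :* (x :* y) := con 1 :* x :* (con 1 :* y)) refl (f 0) (g 0)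
  σ-⊛ a f g (suc n) = begin
    a * a ^ n * ((D f ⊛ g) n + (f ⊛ D g) n)
      ≈⟨ solve 4 (λ a b x y → a :* b :* (x :+ y) := a :* (b :* x) :+ a :* (b :* y)) refl a (a ^ n) _ _ ⟩
    a * σ a (D f ⊛ g) n + a * σ a (f ⊛ D g) n
      ≈⟨ +-cong (*-congˡ (σ-⊛ a (D f) g n)) (*-congˡ (σ-⊛ a f (D g) n)) ⟩
    a * (σ a (D f) ⊛ σ a g) n + a * (σ a f ⊛ σ a (D g)) n
      ≈⟨ +-cong (⊛-scaleˡ a (σ a (D f)) (σ a g) n) (⊛-scaleʳ a (σ a f) (σ a (D g)) n) ⟨
    ((λ k → a * σ a (D f) k) ⊛ σ a g) n + (σ a f ⊛ (λ k → a * σ a (D g) k)) n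
      ≈⟨ +-cong (⊛-cong (λ k → sym (*-assoc _ _ _)) (λ _ → refl) n)
                (⊛-cong {σ a f} (λ _ → refl) (λ k → sym (*-assoc _ _ _)) n) ⟩
    (D (σ a f) ⊛ σ a g) n + (σ a f ⊛ D (σ a g)) n
      ∎

  σ-const : ∀ a b → σ a (const b) ≋ const b
  σ-const a b zero    = *-identityˡ b
  σ-const a b (suc n) = zeroʳ _

  σ-isRingHomomorphism : ∀ a → IsRingHomomorphism H.rawRing H.rawRing (σ a)
  σ-isRingHomomorphism a = record
    { isSemiringHomomorphism = record
      { isNearSemiringHomomorphism = record
        { +-isMonoidHomomorphism = record
          { isMagmaHomomorphism = record
            { isRelHomomorphism = record { cong = λ f≈g n → *-congˡ (f≈g n) }
            ; homo = λ _ _ _ → distribˡ _ _ _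
            }
          ; ε-homo = λ _ → zeroʳ _
          }
        ; *-homo = σ-⊛ a
        }
      ; 1#-homo = σ-const a 1#
      }
    ; -‿homo = λ _ _ → sym (-‿distribʳ-* _ _)
    }
    where open RingProperties ring using (-‿distribʳ-*)

  σ-e : ∀ a x → σ a (e x) ≋ e (a * x)
  σ-e a x n = sym (^-distrib-* a x n)

  -- Cancellation of a series with invertible constant term.

  ⊛-leading : ∀ f g n → (∀ k → k < n → f k ≈ 0#) → (f ⊛ g) n ≈ f n * g 0
  ⊛-leading f g zero    f≈0 = refl
  ⊛-leading f g (suc n) f≈0 = begin
    (D f ⊛ g) n + (f ⊛ D g) n    ≈⟨ +-cong (⊛-leading (D f) g n (λ k k<n → f≈0 (suc k) (s≤s k<n)))
                                           (⊛-leading f (D g) n (λ k k<n → f≈0 k (ℕ.m<n⇒m<1+n k<n))) ⟩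
    -- The leading term of `f ⊛ D g` still involves `f n`, which is among the coefficients assumed
    -- to vanish.
    f (suc n) * g 0 + f n * g 1  ≈⟨ +-congˡ (trans (*-congʳ (f≈0 n (ℕ.n<1+n n))) (zeroˡ _)) ⟩
    f (suc n) * g 0 + 0#         ≈⟨ +-identityʳ _ ⟩
    f (suc n) * g 0              ∎

  -- Strong induction on the index: once the lower coefficients of `f` vanish, the coefficient of
  -- the product is `f k * g 0`, and `g 0` is a unit.
  ⊛-nonZeroDivisor : ∀ f g u → g 0 * u ≈ 1# → f ⊛ g ≋ H.0# → f ≋ H.0#
  ⊛-nonZeroDivisor f g u gu≈1 fg≈0 n = below (suc n) n (ℕ.n<1+n n)
    where
    below : ∀ n k → k < n → f k ≈ 0#
    below (suc n) k k<1+n = begin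
      f k              ≈⟨ *-identityʳ _ ⟨
      f k * 1#         ≈⟨ *-congˡ gu≈1 ⟨
      f k * (g 0 * u)  ≈⟨ *-assoc _ _ _ ⟨
      f k * g 0 * u    ≈⟨ *-congʳ (⊛-leading f g k (λ j j<k → below n j (ℕ.<-≤-trans j<k (s≤s⁻¹ k<1+n)))) ⟨
      (f ⊛ g) k * u    ≈⟨ *-congʳ (fg≈0 k) ⟩
      0# * u           ≈⟨ zeroˡ u ⟩
      0#               ∎

  ⊛-cancelʳ : ∀ f f′ g u → g 0 * u ≈ 1# → f ⊛ g ≋ f′ ⊛ g → f ≋ f′
  ⊛-cancelʳ f f′ g u gu≈1 fg≈f′g = x∙y⁻¹≈ε⇒x≈y f f′
    (⊛-nonZeroDivisor (f H.- f′) g u gu≈1 (H.trans ([y-z]x≈yx-zx g f f′) (x≈y⇒x∙y⁻¹≈ε fg≈f′g)))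
    where
    open GroupProperties H.+-group using (x∙y⁻¹≈ε⇒x≈y; x≈y⇒x∙y⁻¹≈ε)
    open RingProperties H.ring using ([y-z]x≈yx-zx)

-- Evaluation of polynomials, and of power series with polynomial coefficients.

module Evaluation (K : CommutativeRing c ℓ) (x : CommutativeRing.Carrier K) where
  open CommutativeRing K
  open RingOps rawRing using (∑; fromℕ; _^_)
  open Polynomials rawRing
  open Hurwitz K
  open RingLemmas K
  open SetoidReasoning setoid
  open Solver commutativeSemiring
  open RingProperties ring using (-0#≈0#; -‿distribʳ-*)
  open AbelianGroupProperties +-abelianGroup using (⁻¹-∙-comm)
  private
    module K[x] = RawRing polyRing

  eval-const : ∀ a → eval [ a ] x ≈ a
  eval-const a = trans (+-congˡ (zeroʳ x)) (+-identityʳ a)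

  eval-X : eval X x ≈ x
  eval-X = trans (+-identityˡ _) (trans (*-congˡ (eval-const 1#)) (*-identityʳ x))

  eval-zero : ∀ f → f K[x].≈ [] → eval f x ≈ 0#
  eval-zero []      f≈0 = refl
  eval-zero (a ∷ f) f≈0 = begin
    a + x * eval f x  ≈⟨ +-cong (f≈0 0) (*-congˡ (eval-zero f (λ i → f≈0 (suc i)))) ⟩
    0# + x * 0#       ≈⟨ trans (+-identityˡ _) (zeroʳ x) ⟩
    0#                ∎

  -- Equal polynomials may be lists of different lengths, so the surplus zero coefficients are
  -- handled by `eval-zero`.
  eval-cong : ∀ {f g} → f K[x].≈ g → eval f x ≈ eval g x
  eval-cong {[]}    {g}     f≈g = sym (eval-zero g (λ i → sym (f≈g i)))
  eval-cong {a ∷ f} {[]}    f≈g = eval-zero (a ∷ f) f≈g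
  eval-cong {a ∷ f} {b ∷ g} f≈g = +-cong (f≈g 0) (*-congˡ (eval-cong {f} {g} (λ i → f≈g (suc i))))

  eval-+ : ∀ f g → eval (f +ᵖ g) x ≈ eval f x + eval g x
  eval-+ []      g       = sym (+-identityˡ _)
  eval-+ (a ∷ f) []      = sym (+-identityʳ _)
  eval-+ (a ∷ f) (b ∷ g) = trans (+-congˡ (*-congˡ (eval-+ f g)))
    (solve 5 (λ a b x y z → a :+ b :+ x :* (y :+ z) := a :+ x :* y :+ (b :+ x :* z)) refl a b x _ _)

  eval-scale : ∀ a f → eval (map (a *_) f) x ≈ a * eval f x
  eval-scale a []      = sym (zeroʳ a)
  eval-scale a (b ∷ f) = trans (+-congˡ (*-congˡ (eval-scale a f)))
    (solve 4 (λ a b x y → a :* b :+ x :* (a :* y) := a :* (b :+ x :* y)) refl a b x _)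

  eval-* : ∀ f g → eval (f *ᵖ g) x ≈ eval f x * eval g x
  eval-* []      g = sym (zeroˡ _)
  eval-* (a ∷ f) g = begin
    eval (map (a *_) g +ᵖ (0# ∷ f *ᵖ g)) x              ≈⟨ eval-+ (map (a *_) g) (0# ∷ f *ᵖ g) ⟩
    eval (map (a *_) g) x + (0# + x * eval (f *ᵖ g) x)  ≈⟨ +-cong (eval-scale a g) (+-congˡ (*-congˡ (eval-* f g))) ⟩
    a * eval g x + (0# + x * (eval f x * eval g x))     ≈⟨ solve 4 (λ a x y z → a :* z :+ (con 0 :+ x :* (y :* z)) := (a :+ x :* y) :* z)
                                                             refl a x _ _ ⟩
    (a + x * eval f x) * eval g x                       ∎

  eval-neg : ∀ f → eval (map (-_) f) x ≈ - eval f x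
  eval-neg []      = sym -0#≈0#
  eval-neg (a ∷ f) = begin
    - a + x * eval (map (-_) f) x  ≈⟨ +-congˡ (*-congˡ (eval-neg f)) ⟩
    - a + x * - eval f x           ≈⟨ +-congˡ (-‿distribʳ-* x _) ⟨
    - a + - (x * eval f x)         ≈⟨ ⁻¹-∙-comm _ _ ⟩
    - (a + x * eval f x)           ∎

  eval-isRingHomomorphism : IsRingHomomorphism polyRing rawRing (λ f → eval f x)
  eval-isRingHomomorphism = record
    { isSemiringHomomorphism = record
      { isNearSemiringHomomorphism = record
        { +-isMonoidHomomorphism = record
          { isMagmaHomomorphism = record
            { isRelHomomorphism = record { cong = λ {f} {g} → eval-cong {f} {g} }
            ; homo = eval-+
            }
          ; ε-homo = refl
          }
        ; *-homo = eval-*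
        }
      ; 1#-homo = eval-const 1#
      }
    ; -‿homo = eval-neg
    }

  open PowerSeries polyRing using (Series; const; seriesRing)
  module EvalHom = HomomorphismLemmas K eval-isRingHomomorphism

  -- The passage from K[x][[t]] to exponential generating functions over `K`; being a ring
  -- homomorphism, it transports the defining formula of `E`.
  evalSeries : Series → PowerSeries.Series rawRing
  evalSeries F = hurwitz (λ n → eval (F n) x)

  evalSeries-const : ∀ f → evalSeries (const f) ≋ PowerSeries.const rawRing (eval f x)
  evalSeries-const f zero    = trans (*-congʳ (+-identityʳ 1#)) (*-identityˡ _)
  evalSeries-const f (suc n) = zeroʳ _

  evalSeries-isRingHomomorphism : IsRingHomomorphism seriesRing H.rawRing evalSeries
  evalSeries-isRingHomomorphism = record
    { isSemiringHomomorphism = record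
      { isNearSemiringHomomorphism = record
        { +-isMonoidHomomorphism = record
          { isMagmaHomomorphism = record
            { isRelHomomorphism = record { cong = λ {F} {G} F≈G n → *-congˡ (eval-cong {F n} {G n} (F≈G n)) }
            ; homo = λ F G n → trans (*-congˡ (eval-+ (F n) (G n))) (distribˡ _ _ _)
            }
          ; ε-homo = λ n → zeroʳ _
          }
        ; *-homo = λ F G n → trans
            (*-congˡ (trans (EvalHom.homo-∑ (suc n) (λ k → F k *ᵖ G (n ∸ k)))
                            (∑-cong (suc n) (λ k _ → eval-* (F k) (G (n ∸ k))))))
            (hurwitz-* (λ k → eval (F k) x) (λ k → eval (G k) x) n)
        }
      ; 1#-homo = λ n → trans (evalSeries-const [ 1# ] n) (const-cong (eval-const 1#) n)
      }
    ; -‿homo = λ F n → trans (*-congˡ (eval-neg (F n))) (sym (-‿distribʳ-* _ _))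
    }

  evalSeries-quotient : ∀ F G u (u*G₀≈1 : u K[x].* G 0 K[x].≈ K[x].1#) →
    evalSeries G ⊛ evalSeries (PowerSeries.quotient polyRing F G u u*G₀≈1) ≋ evalSeries F
  evalSeries-quotient F G u u*G₀≈1 n = trans
    (sym (hurwitz-* (λ k → eval (G k) x) (λ k → eval (PowerSeries.quotient polyRing F G u u*G₀≈1 k) x) n))
    (*-congˡ (EvalHom.homo-quotient F G u u*G₀≈1 n))

-- Fractions of natural numbers.

module ℚOps = RingOps ℚ.+-*-rawRing

-- A normalised fraction is reduced by a gcd and does not compute for a variable numerator; among
-- unnormalised fractions the claim becomes integer arithmetic.
ℚ-fromℕ : ∀ n → ℚOps.fromℕ n ≡ + n ℚ./ 1
ℚ-fromℕ zero    = ≡.refl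
ℚ-fromℕ (suc n) = ℚ.toℚᵘ-injective (begin
  toℚᵘ (1ℚ ℚ.+ ℚOps.fromℕ n)              ≡⟨ ≡.cong (λ q → toℚᵘ (1ℚ ℚ.+ q)) (ℚ-fromℕ n) ⟩
  toℚᵘ (1ℚ ℚ.+ (+ n ℚ./ 1))               ≈⟨ ℚ.toℚᵘ-homo-+ 1ℚ (+ n ℚ./ 1) ⟩
  ℚᵘ.1ℚᵘ ℚᵘ.+ toℚᵘ (+ n ℚ./ 1)            ≈⟨ ℚᵘ.+-congʳ ℚᵘ.1ℚᵘ (ℚ.toℚᵘ-fromℚᵘ (ℚᵘ.mkℚᵘ (+ n) 0)) ⟩
  ℚᵘ.1ℚᵘ ℚᵘ.+ ℚᵘ.mkℚᵘ (+ n) 0             ≡⟨ ≡.cong (λ i → ℚᵘ.mkℚᵘ (+ 1 ℤ.+ i) 0) (ℤ.*-identityʳ (+ n)) ⟩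
  ℚᵘ.mkℚᵘ (+ suc n) 0                     ≈⟨ ℚ.toℚᵘ-fromℚᵘ (ℚᵘ.mkℚᵘ (+ suc n) 0) ⟨
  toℚᵘ (+ suc n ℚ./ 1)                    ∎)
  where open ℚᵘ.≃-Reasoning

/-*-cancel : ∀ v u .{{_ : NonZero u}} → (+ v ℚ./ u) ℚ.* (+ u ℚ./ 1) ≡ + v ℚ./ 1
/-*-cancel v u@(suc u-1) = ℚ.toℚᵘ-injective (begin
  toℚᵘ ((+ v ℚ./ u) ℚ.* (+ u ℚ./ 1))         ≈⟨ ℚ.toℚᵘ-homo-* (+ v ℚ./ u) (+ u ℚ./ 1) ⟩
  toℚᵘ (+ v ℚ./ u) ℚᵘ.* toℚᵘ (+ u ℚ./ 1)     ≈⟨ ℚᵘ.*-cong (ℚ.toℚᵘ-fromℚᵘ (ℚᵘ.mkℚᵘ (+ v) u-1))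
                                                             (ℚ.toℚᵘ-fromℚᵘ (ℚᵘ.mkℚᵘ (+ u) 0)) ⟩
  ℚᵘ.mkℚᵘ (+ v) u-1 ℚᵘ.* ℚᵘ.mkℚᵘ (+ u) 0     ≈⟨ ℚᵘ.*≡* (ℤ.*-assoc (+ v) (+ u) (+ 1)) ⟩
  ℚᵘ.mkℚᵘ (+ v) 0                            ≈⟨ ℚ.toℚᵘ-fromℚᵘ (ℚᵘ.mkℚᵘ (+ v) 0) ⟨
  toℚᵘ (+ v ℚ./ 1)                           ∎)
  where open ℚᵘ.≃-Reasoning

-- Generating functions of Euler values and alternating power sums.

module EulerSeries
  (K : CommutativeRing c ℓ) (ι : ℚ → CommutativeRing.Carrier K)
  (ι-hom : IsRingHomomorphism ℚ.+-*-rawRing (CommutativeRing.rawRing K) ι)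
  (d : ℕ) (χ : ℕ → CommutativeRing.Carrier K) where
  open CommutativeRing K
  open RingOps rawRing using (∑; fromℕ; _^_)
  open PowerSeries rawRing using (Series; const)
  open GeneralizedEuler K ι ι-hom d χ
  open Hurwitz K
  open RingLemmas K
  open ExpProperties commutativeSemiring using (^-distrib-*; ^-congˡ; ^-homo-*)

  private
    module KReasoning = SetoidReasoning setoid
    module HReasoning = SetoidReasoning H.setoid
    module KSolver = Solver commutativeSemiring
    module HSolver = Solver H.commutativeSemiring
    module ι = IsRingHomomorphism ι-hom
    module ιLemmas = HomomorphismLemmas K ι-hom
    module constHom = IsRingHomomorphism const-isRingHomomorphism
    module constLemmas = HomomorphismLemmas commutativeRing const-isRingHomomorphism

  -- Serves two purposes: it removes v/u from the Euler arguments and cancels the factorials in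
  -- `Generating.exp`.
  ι-/ : ∀ v u .{{_ : NonZero u}} → ι (+ v ℚ./ u) * fromℕ u ≈ fromℕ v
  ι-/ v u = begin
    ι (+ v ℚ./ u) * fromℕ u              ≈⟨ *-congˡ (ιLemmas.homo-fromℕ u) ⟨
    ι (+ v ℚ./ u) * ι (ℚOps.fromℕ u)     ≈⟨ ι.*-homo _ _ ⟨
    ι ((+ v ℚ./ u) ℚ.* ℚOps.fromℕ u)     ≡⟨ ≡.cong (λ q → ι ((+ v ℚ./ u) ℚ.* q)) (ℚ-fromℕ u) ⟩
    ι ((+ v ℚ./ u) ℚ.* (+ u ℚ./ 1))      ≡⟨ ≡.cong ι (/-*-cancel v u) ⟩
    ι (+ v ℚ./ 1)                        ≡⟨ ≡.cong ι (ℚ-fromℕ v) ⟨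
    ι (ℚOps.fromℕ v)                     ≈⟨ ιLemmas.homo-fromℕ v ⟩
    fromℕ v                              ∎
    where open KReasoning

  ι-1/n! : ∀ n → ι (Generating.1/ n !) * fromℕ (n !) ≈ 1#
  ι-1/n! n = trans (ι-/ 1 (n !) {{n ℕ.!≢0}}) (+-identityʳ 1#)

  2*½≈1 : (1# + 1#) * ι ½ ≈ 1#
  2*½≈1 = begin
    (1# + 1#) * ι ½                          ≈⟨ *-congʳ (+-cong ι.1#-homo ι.1#-homo) ⟨
    (ι 1ℚ + ι 1ℚ) * ι ½                      ≈⟨ *-congʳ (ι.+-homo 1ℚ 1ℚ) ⟨
    ι (1ℚ ℚ.+ 1ℚ) * ι ½                      ≈⟨ ι.*-homo (1ℚ ℚ.+ 1ℚ) ½ ⟨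
    ι 1ℚ                                     ≈⟨ ι.1#-homo ⟩
    1#                                       ∎
    where open KReasoning

  coefficient : ℕ → Carrier
  coefficient a = (- 1#) ^ a * χ a

  powerSums : ℕ → Series
  powerSums m = HOps.∑[ a < m ] (const (coefficient a) ⊛ e (fromℕ a))

  -- The upper limit of `T` is inclusive, whereas `powerSums` takes the number of terms.
  T≈powerSums : ∀ n m → T n m ≈ powerSums (suc m) n
  T≈powerSums n m = trans
    (∑-cong (suc m) (λ a _ → sym (const-⊛ (coefficient a) (e (fromℕ a)) n)))
    (sym (∑-pointwise (suc m) (λ a → const (coefficient a) ⊛ e (fromℕ a)) n))

  eulerValues : Carrier → Series
  eulerValues x n = eval (E n) x

  module _ (x : Carrier) where
    open Evaluation K x
    private
      module evalSeriesHom = IsRingHomomorphism evalSeries-isRingHomomorphism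
      module evalSeriesLemmas = HomomorphismLemmas commutativeRing evalSeries-isRingHomomorphism
      module K[x] = RingOps polyRing
      module K[x][[t]] = RingOps Generating.seriesRing

    evalSeries-exp : ∀ p → evalSeries (Generating.exp p) ≋ e (eval p x)
    evalSeries-exp p n = begin
      fromℕ (n !) * eval (K[x]._*_ (ι (Generating.1/ n !) ∷ []) (p K[x].^ n)) x
        ≈⟨ *-congˡ (trans (eval-* (ι (Generating.1/ n !) ∷ []) (p K[x].^ n))
             (*-cong (eval-const _) (EvalHom.homo-^ p n))) ⟩
      fromℕ (n !) * (ι (Generating.1/ n !) * eval p x ^ n)
        ≈⟨ solve 3 (λ a b c → a :* (b :* c) := b :* a :* c) refl _ _ _ ⟩
      ι (Generating.1/ n !) * fromℕ (n !) * eval p x ^ n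
        ≈⟨ *-congʳ (ι-1/n! n) ⟩
      1# * eval p x ^ n
        ≈⟨ *-identityˡ _ ⟩
      eval p x ^ n
        ∎
      where
      open KReasoning
      open KSolver

    evalSeries-exp-fromℕ : ∀ a → evalSeries (Generating.exp (K[x].fromℕ a)) ≋ e (fromℕ a)
    evalSeries-exp-fromℕ a = H.trans (evalSeries-exp (K[x].fromℕ a)) (e-cong (EvalHom.homo-fromℕ a))

    -- Both sides are the a-th power of -1 in the ring of exponential generating functions, since
    -- `evalSeries` and `const` are ring homomorphisms.
    evalSeries-sign : ∀ a → evalSeries ((K[x][[t]].- K[x][[t]].1#) K[x][[t]].^ a) ≋ const ((- 1#) ^ a)
    evalSeries-sign a = H.trans (evalSeriesLemmas.homo-^ (K[x][[t]].- K[x][[t]].1#) a) (H.trans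
      (HExp.^-congˡ a (H.trans (evalSeriesHom.-‿homo K[x][[t]].1#)
        (H.trans (H.-‿cong evalSeriesHom.1#-homo) (H.sym (constHom.-‿homo 1#)))))
      (H.sym (constLemmas.homo-^ (- 1#) a)))
      where module HExp = ExpProperties H.commutativeSemiring

    evalSeries-numerator : evalSeries Generating.numerator ≋ HOps.fromℕ 2 ⊛ e x ⊛ powerSums d
    evalSeries-numerator = H.trans (evalSeriesHom.*-homo (K[x][[t]].fromℕ 2 K[x][[t]].* Generating.exp X) sum)
      (H.*-cong
        (H.trans (evalSeriesHom.*-homo (K[x][[t]].fromℕ 2) (Generating.exp X))
          (H.*-cong (evalSeriesLemmas.homo-fromℕ 2) (H.trans (evalSeries-exp X) (e-cong eval-X))))
        (H.trans (evalSeriesLemmas.homo-∑ d term) (HLemmas.∑-cong d (λ a _ → evalSeries-term a))))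
      where
      sign : ℕ → Generating.Series
      sign a = (K[x][[t]].- K[x][[t]].1#) K[x][[t]].^ a
      term : ℕ → Generating.Series
      term a = sign a K[x][[t]].* Generating.const [ χ a ] K[x][[t]].* Generating.exp (K[x].fromℕ a)
      sum : Generating.Series
      sum = K[x][[t]].∑[ a < d ] term a
      evalSeries-term : ∀ a → evalSeries (term a) ≋ const (coefficient a) ⊛ e (fromℕ a)
      evalSeries-term a = H.trans
        (evalSeriesHom.*-homo (sign a K[x][[t]].* Generating.const [ χ a ]) (Generating.exp (K[x].fromℕ a)))
        (H.*-cong
          (H.trans (evalSeriesHom.*-homo (sign a) (Generating.const [ χ a ]))
            (H.trans (H.*-cong (evalSeries-sign a)
              (H.trans (evalSeries-const [ χ a ]) (const-cong (eval-const (χ a)))))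
              (H.sym (constHom.*-homo ((- 1#) ^ a) (χ a)))))
          (evalSeries-exp-fromℕ a))

    evalSeries-denominator : evalSeries Generating.denominator ≋ e (fromℕ d) H.+ H.1#
    evalSeries-denominator = H.trans (evalSeriesHom.+-homo (Generating.exp (K[x].fromℕ d)) K[x][[t]].1#)
      (H.+-cong (evalSeries-exp-fromℕ d) evalSeriesHom.1#-homo)

    eulerValues-evalSeries : eulerValues x ≋ evalSeries Generating.generatingFunction
    eulerValues-evalSeries n = trans (eval-* (K[x].fromℕ (n !)) (Generating.generatingFunction n))
      (*-congʳ (EvalHom.homo-fromℕ (n !)))

    -- The definition of the Euler polynomials, evaluated at `x` and cleared of its denominator.
    -- This is the only property of `E` used from here on.
    eulerValues-generating : eulerValues x ⊛ (e (fromℕ d) H.+ H.1#) ≋ HOps.fromℕ 2 ⊛ e x ⊛ powerSums d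
    eulerValues-generating = H.trans
      (H.trans (H.*-comm _ _) (H.*-cong (H.sym evalSeries-denominator) eulerValues-evalSeries))
      (H.trans (evalSeries-quotient Generating.numerator Generating.denominator [ ι ½ ] Generating.½-inverse)
        evalSeries-numerator)

  -- The substitution t ↦ st in these generating functions.

  powerSumsAt : ℕ → Carrier → Series
  powerSumsAt m s = σ s (powerSums m)

  powerSumsAt-cong : ∀ m {s s′} → s ≈ s′ → powerSumsAt m s ≋ powerSumsAt m s′
  powerSumsAt-cong m s≈s′ n = *-congʳ (^-congˡ n s≈s′)

  powerSumsAt-∑ : ∀ m s → powerSumsAt m s ≋ HOps.∑[ a < m ] (const (coefficient a) ⊛ e (s * fromℕ a))
  powerSumsAt-∑ m s = H.trans
    (HomomorphismLemmas.homo-∑ commutativeRing (σ-isRingHomomorphism s) m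
      (λ a → const (coefficient a) ⊛ e (fromℕ a)))
    (HLemmas.∑-cong m (λ a _ → H.trans (σ-⊛ s (const (coefficient a)) (e (fromℕ a)))
      (H.*-cong (σ-const s (coefficient a)) (σ-e s (fromℕ a)))))

  -- In the notation of the overview, `powerSumsAt d s` is A(st), `period s` is e^(dst) and `den s`
  -- is D(st).
  period : Carrier → Series
  period s = e (s * fromℕ d)

  den : Carrier → Series
  den s = period s H.+ H.1#

  den-cong : ∀ {s s′} → s ≈ s′ → den s ≋ den s′
  den-cong s≈s′ = H.+-congʳ (e-cong (*-congʳ s≈s′))

  period-^ : ∀ s u → period s HOps.^ u ≋ period (fromℕ u * s)
  period-^ s zero    = H.sym (H.trans (e-cong (trans (*-congʳ (zeroˡ s)) (zeroˡ _))) e-0)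
  period-^ s (suc u) = H.trans (H.*-congˡ {period s} (period-^ s u)) (H.sym (H.trans
    (e-cong (solve 3 (λ u s d → (con 1 :+ u) :* s :* d := s :* d :+ u :* s :* d) refl (fromℕ u) s (fromℕ d)))
    (e-+ (s * fromℕ d) (fromℕ u * s * fromℕ d))))
    where open KSolver

  σ-eulerValues : ∀ s x → σ s (eulerValues x) ⊛ den s ≋ HOps.fromℕ 2 ⊛ e (s * x) ⊛ powerSumsAt d s
  σ-eulerValues s x = H.trans
    (H.trans (H.*-congˡ {σ s (eulerValues x)} (H.+-cong (H.sym (σ-e s (fromℕ d))) (H.sym σHom.1#-homo)))
      (H.trans (H.*-congˡ {σ s (eulerValues x)} (H.sym (σHom.+-homo (e (fromℕ d)) H.1#)))
        (H.sym (σ-⊛ s (eulerValues x) (e (fromℕ d) H.+ H.1#)))))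
    (H.trans (σHom.⟦⟧-cong (eulerValues-generating x))
      (H.trans (σ-⊛ s (HOps.fromℕ 2 ⊛ e x) (powerSums d))
        (H.*-congʳ {powerSumsAt d s} (H.trans (σ-⊛ s (HOps.fromℕ 2) (e x))
          (H.*-cong (HomomorphismLemmas.homo-fromℕ commutativeRing (σ-isRingHomomorphism s) 2) (σ-e s x))))))
    where module σHom = IsRingHomomorphism (σ-isRingHomomorphism s)

  -- The generating function of `expression`.

  module _ (y : Carrier) (u v w : ℕ) .{{_ : NonZero u}} where
    private
      U V W : Carrier
      U = fromℕ u
      V = fromℕ v
      W = fromℕ w

    shifted : ℕ → Carrier
    shifted a = V * y + ι (+ v ℚ./ u) * fromℕ a

    characterSums : Series
    characterSums k = ∑[ a < u ℕ.* d ] (coefficient a * eulerValues (shifted a) k)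

    characterSums-∑ : characterSums ≋ HOps.∑[ a < u ℕ.* d ] (const (coefficient a) ⊛ eulerValues (shifted a))
    characterSums-∑ k = trans
      (∑-cong (u ℕ.* d) (λ a _ → sym (const-⊛ (coefficient a) (eulerValues (shifted a)) k)))
      (sym (∑-pointwise (u ℕ.* d) (λ a → const (coefficient a) ⊛ eulerValues (shifted a)) k))

    -- Here u cancels the denominator of v/u, and the dependence on `a` becomes that of a power sum
    -- at vw.
    e-shifted : ∀ a → e (U * W * shifted a) ≋ e (U * V * W * y) ⊛ e (V * W * fromℕ a)
    e-shifted a = H.trans
      (e-cong (trans
        (solve 6 (λ u v w y i a → u :* w :* (v :* y :+ i :* a) := u :* v :* w :* y :+ i :* u :* w :* a)
           refl U V W y (ι (+ v ℚ./ u)) (fromℕ a))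
        (+-congˡ (*-congʳ (*-congʳ (ι-/ v u))))))
      (e-+ (U * V * W * y) (V * W * fromℕ a))
      where open KSolver

    -- One denominator serves all summands. After clearing it they differ only in the coefficient
    -- and in e^(vwat), so the rest factors out and a power sum of length ud remains.
    σ-characterSums : σ (U * W) characterSums ⊛ den (U * W) ≋
      HOps.fromℕ 2 ⊛ e (U * V * W * y) ⊛ powerSumsAt d (U * W) ⊛ powerSumsAt (u ℕ.* d) (V * W)
    σ-characterSums = begin
      σ s characterSums ⊛ den s
        ≈⟨ H.*-congʳ {den s} (H.trans (σHom.⟦⟧-cong characterSums-∑)
             (HomomorphismLemmas.homo-∑ commutativeRing (σ-isRingHomomorphism s) (u ℕ.* d)
               (λ a → const (coefficient a) ⊛ eulerValues (shifted a)))) ⟩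
      HOps.∑[ a < u ℕ.* d ] σ s (const (coefficient a) ⊛ eulerValues (shifted a)) ⊛ den s
        ≈⟨ HLemmas.∑-distribʳ (u ℕ.* d) (den s) (λ a → σ s (const (coefficient a) ⊛ eulerValues (shifted a))) ⟩
      HOps.∑[ a < u ℕ.* d ] (σ s (const (coefficient a) ⊛ eulerValues (shifted a)) ⊛ den s)
        ≈⟨ HLemmas.∑-cong (u ℕ.* d) (λ a _ → term a) ⟩
      HOps.∑[ a < u ℕ.* d ] (common ⊛ (const (coefficient a) ⊛ e (V * W * fromℕ a)))
        ≈⟨ HLemmas.∑-distribˡ (u ℕ.* d) common (λ a → const (coefficient a) ⊛ e (V * W * fromℕ a)) ⟨
      common ⊛ HOps.∑[ a < u ℕ.* d ] (const (coefficient a) ⊛ e (V * W * fromℕ a))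
        ≈⟨ H.*-congˡ {common} (powerSumsAt-∑ (u ℕ.* d) (V * W)) ⟨
      common ⊛ powerSumsAt (u ℕ.* d) (V * W)
        ∎
      where
      open HReasoning
      s : Carrier
      s = U * W
      common : Series
      common = HOps.fromℕ 2 ⊛ e (U * V * W * y) ⊛ powerSumsAt d s
      module σHom = IsRingHomomorphism (σ-isRingHomomorphism s)
      open HSolver
      term : ∀ a → σ s (const (coefficient a) ⊛ eulerValues (shifted a)) ⊛ den s ≋
        common ⊛ (const (coefficient a) ⊛ e (V * W * fromℕ a))
      term a = begin
        σ s (const κ ⊛ eulerValues (shifted a)) ⊛ den s
          ≈⟨ H.*-congʳ {den s} (H.trans (σ-⊛ s (const κ) (eulerValues (shifted a)))
               (H.*-congʳ {σ s (eulerValues (shifted a))} (σ-const s κ))) ⟩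
        const κ ⊛ σ s (eulerValues (shifted a)) ⊛ den s
          ≈⟨ H.*-assoc (const κ) (σ s (eulerValues (shifted a))) (den s) ⟩
        const κ ⊛ (σ s (eulerValues (shifted a)) ⊛ den s)
          ≈⟨ H.*-congˡ {const κ} (σ-eulerValues s (shifted a)) ⟩
        const κ ⊛ (HOps.fromℕ 2 ⊛ e (s * shifted a) ⊛ powerSumsAt d s)
          ≈⟨ H.*-congˡ {const κ} (H.*-congʳ {powerSumsAt d s} (H.*-congˡ {HOps.fromℕ 2} (e-shifted a))) ⟩
        const κ ⊛ (HOps.fromℕ 2 ⊛ (e (U * V * W * y) ⊛ e (V * W * fromℕ a)) ⊛ powerSumsAt d s)
          ≈⟨ solve 5 (λ k t x z p → k :* (t :* (x :* z) :* p) := t :* x :* p :* (k :* z))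
               (λ _ → refl) (const κ) (HOps.fromℕ 2) (e (U * V * W * y)) (e (V * W * fromℕ a)) (powerSumsAt d s) ⟩
        common ⊛ (const κ ⊛ e (V * W * fromℕ a))
          ∎
        where
        κ : Carrier
        κ = coefficient a

    -- Splitting `U ^ n` as `U ^ k * U ^ (n ∸ k)` gives the weight `(U * W) ^ k` to the Euler values
    -- and `(U * V) ^ (n ∸ k)` to `T`, so the sum over k is a binomial convolution.
    expression-⊛ : .{{_ : NonZero (w ℕ.* d)}} →
      (λ n → expression n y u v w) ≋ σ (U * W) characterSums ⊛ powerSumsAt (w ℕ.* d) (U * V)
    expression-⊛ n = begin
      U ^ n * ∑[ k < suc n ] (fromℕ (n C k) * characterSums k * T (n ∸ k) m * V ^ (n ∸ k) * W ^ k)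
        ≈⟨ ∑-distribˡ (suc n) (U ^ n) (λ k → fromℕ (n C k) * characterSums k * T (n ∸ k) m * V ^ (n ∸ k) * W ^ k) ⟩
      ∑[ k < suc n ] (U ^ n * (fromℕ (n C k) * characterSums k * T (n ∸ k) m * V ^ (n ∸ k) * W ^ k))
        ≈⟨ ∑-cong (suc n) (λ k k<1+n → term k (s≤s⁻¹ k<1+n)) ⟩
      ∑[ k < suc n ] (fromℕ (n C k) * (σ (U * W) characterSums k * powerSumsAt (w ℕ.* d) (U * V) (n ∸ k)))
        ≈⟨ ⊛-binomial (σ (U * W) characterSums) (powerSumsAt (w ℕ.* d) (U * V)) n ⟨
      (σ (U * W) characterSums ⊛ powerSumsAt (w ℕ.* d) (U * V)) n
        ∎
      where
      open KReasoning
      open KSolver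
      m : ℕ
      m = w ℕ.* d ∸ 1
      -- `suc m` is `w ℕ.* d` because the product is nonzero and the truncated subtraction loses
      -- nothing.
      T≈ : ∀ j → T j m ≈ powerSums (w ℕ.* d) j
      T≈ j = trans (T≈powerSums j m) (reflexive (≡.cong (λ l → powerSums l j) (ℕ.suc-pred (w ℕ.* d))))
      term : ∀ k → k ≤ n → U ^ n * (fromℕ (n C k) * characterSums k * T (n ∸ k) m * V ^ (n ∸ k) * W ^ k) ≈
        fromℕ (n C k) * (σ (U * W) characterSums k * powerSumsAt (w ℕ.* d) (U * V) (n ∸ k))
      term k k≤n = begin
        U ^ n * (b * p * T (n ∸ k) m * V ^ (n ∸ k) * W ^ k)
          ≈⟨ *-cong U^n (*-congʳ (*-congʳ (*-congˡ (T≈ (n ∸ k))))) ⟩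
        U ^ k * U ^ (n ∸ k) * (b * p * t * V ^ (n ∸ k) * W ^ k)
          ≈⟨ solve 7 (λ u₁ u₂ b p t v w → u₁ :* u₂ :* (b :* p :* t :* v :* w) := b :* (u₁ :* w :* p :* (u₂ :* v :* t)))
               refl (U ^ k) (U ^ (n ∸ k)) b p t (V ^ (n ∸ k)) (W ^ k) ⟩
        b * (U ^ k * W ^ k * p * (U ^ (n ∸ k) * V ^ (n ∸ k) * t))
          ≈⟨ *-congˡ (*-cong (*-congʳ (^-distrib-* U W k)) (*-congʳ (^-distrib-* U V (n ∸ k)))) ⟨
        b * ((U * W) ^ k * p * ((U * V) ^ (n ∸ k) * t))
          ∎
        where
        b p t : Carrier
        b = fromℕ (n C k)
        p = characterSums k
        t = powerSums (w ℕ.* d) (n ∸ k)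
        U^n : U ^ n ≈ U ^ k * U ^ (n ∸ k)
        U^n = trans (reflexive (≡.cong (U ^_) (≡.sym (ℕ.m+[n∸m]≡n k≤n)))) (^-homo-* U k (n ∸ k))

  -- Antiperiodic coefficients and sums over an odd number of periods.

  module Periodic (odd-d : Odd d) (χ-periodic : ∀ a → χ (d ℕ.+ a) ≈ χ a) where
    1^n≈1 : ∀ n → 1# ^ n ≈ 1#
    1^n≈1 zero    = refl
    1^n≈1 (suc n) = trans (*-identityˡ _) (1^n≈1 n)

    coefficient-antiperiodic : ∀ a → coefficient (d ℕ.+ a) ≈ - coefficient a
    coefficient-antiperiodic a = begin
      (- 1#) ^ (d ℕ.+ a) * χ (d ℕ.+ a)    ≈⟨ *-cong (^-homo-* (- 1#) d a) (χ-periodic a) ⟩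
      (- 1#) ^ d * (- 1#) ^ a * χ a       ≈⟨ *-assoc _ _ _ ⟩
      (- 1#) ^ d * coefficient a          ≈⟨ *-congʳ (trans (odd-^ odd-d 1#) (-‿cong (1^n≈1 d))) ⟩
      - 1# * coefficient a                ≈⟨ RingProperties.-1*x≈-x ring (coefficient a) ⟩
      - coefficient a                     ∎
      where open KReasoning

    -- Moving a term by one period multiplies it by -e^(dst): the sign comes from antiperiodicity,
    -- the exponential from the exponent.
    powerSumsAt-+ : ∀ m s → powerSumsAt (d ℕ.+ m) s ≋ powerSumsAt d s H.+ H.- period s ⊛ powerSumsAt m s
    powerSumsAt-+ m s = begin
      powerSumsAt (d ℕ.+ m) s
        ≈⟨ powerSumsAt-∑ (d ℕ.+ m) s ⟩
      HOps.∑[ a < d ℕ.+ m ] term a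
        ≈⟨ HLemmas.∑-++ d m term ⟩
      HOps.∑[ a < d ] term a H.+ HOps.∑[ a < m ] term (d ℕ.+ a)
        ≈⟨ H.+-cong (H.sym (powerSumsAt-∑ d s)) (HLemmas.∑-cong m (λ a _ → term-shift a)) ⟩
      powerSumsAt d s H.+ HOps.∑[ a < m ] (H.- period s ⊛ term a)
        ≈⟨ H.+-congˡ {powerSumsAt d s} (H.trans (H.sym (HLemmas.∑-distribˡ m (H.- period s) term))
             (H.*-congˡ {H.- period s} (H.sym (powerSumsAt-∑ m s)))) ⟩
      powerSumsAt d s H.+ H.- period s ⊛ powerSumsAt m s
        ∎
      where
      open HReasoning
      open CommutativeSemigroupProperties H.*-commutativeSemigroup using (x∙yz≈y∙xz)
      module HProps = RingProperties H.ring
      term : ℕ → Series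
      term a = const (coefficient a) ⊛ e (s * fromℕ a)
      exponent : ∀ a → s * fromℕ (d ℕ.+ a) ≈ s * fromℕ d + s * fromℕ a
      exponent a = trans (*-congˡ (MultProperties.×-homo-+ semiring 1# d a)) (distribˡ _ _ _)
      term-shift : ∀ a → term (d ℕ.+ a) ≋ H.- period s ⊛ term a
      term-shift a = begin
        const (coefficient (d ℕ.+ a)) ⊛ e (s * fromℕ (d ℕ.+ a))
          ≈⟨ H.*-cong (H.trans (const-cong (coefficient-antiperiodic a)) (constHom.-‿homo (coefficient a)))
                      (H.trans (e-cong (exponent a)) (e-+ (s * fromℕ d) (s * fromℕ a))) ⟩
        H.- const (coefficient a) ⊛ (period s ⊛ e (s * fromℕ a))
          ≈⟨ HProps.-‿distribˡ-* (const (coefficient a)) (period s ⊛ e (s * fromℕ a)) ⟨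
        H.- (const (coefficient a) ⊛ (period s ⊛ e (s * fromℕ a)))
          ≈⟨ H.-‿cong (x∙yz≈y∙xz (const (coefficient a)) (period s) (e (s * fromℕ a))) ⟩
        H.- (period s ⊛ term a)
          ≈⟨ HProps.-‿distribˡ-* (period s) (term a) ⟩
        H.- period s ⊛ term a
          ∎

    -- The geometric sum A (1 - pᵘ) with the power moved to the other side, so that its induction step
    -- needs no subtraction beyond q + p = 0.
    powerSumsAt-geometric : ∀ u s →
      powerSumsAt (u ℕ.* d) s ⊛ den s H.+ powerSumsAt d s ⊛ (H.- period s) HOps.^ u ≋ powerSumsAt d s
    powerSumsAt-geometric zero s = H.trans
      (H.+-cong (H.trans (H.*-congʳ {den s} (λ _ → zeroʳ _)) (H.zeroˡ (den s))) (H.*-identityʳ (powerSumsAt d s)))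
      (H.+-identityˡ (powerSumsAt d s))
    powerSumsAt-geometric (suc u) s = begin
      powerSumsAt (d ℕ.+ u ℕ.* d) s ⊛ (q H.+ H.1#) H.+ A ⊛ (p ⊛ pᵘ)
        ≈⟨ H.+-congʳ {A ⊛ (p ⊛ pᵘ)} (H.*-congʳ {q H.+ H.1#} (powerSumsAt-+ (u ℕ.* d) s)) ⟩
      (A H.+ p ⊛ B) ⊛ (q H.+ H.1#) H.+ A ⊛ (p ⊛ pᵘ)
        ≈⟨ solve 5 (λ a b p q r → (a :+ p :* b) :* (q :+ con 1) :+ a :* (p :* r) :=
             a :* q :+ a :+ p :* (b :* (q :+ con 1) :+ a :* r)) (λ _ → refl) A B p q pᵘ ⟩
      A ⊛ q H.+ A H.+ p ⊛ (B ⊛ (q H.+ H.1#) H.+ A ⊛ pᵘ)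
        ≈⟨ H.+-congˡ {A ⊛ q H.+ A} (H.*-congˡ {p} (powerSumsAt-geometric u s)) ⟩
      A ⊛ q H.+ A H.+ p ⊛ A
        ≈⟨ solve 3 (λ a p q → a :* q :+ a :+ p :* a := a :* (q :+ p) :+ a) (λ _ → refl) A p q ⟩
      A ⊛ (q H.+ p) H.+ A
        ≈⟨ H.+-congʳ {A} (H.trans (H.*-congˡ {A} (H.-‿inverseʳ q)) (H.zeroʳ A)) ⟩
      H.0# H.+ A
        ≈⟨ H.+-identityˡ A ⟩
      A ∎
      where
      open HReasoning
      open HSolver
      A B p q pᵘ : Series
      A = powerSumsAt d s
      B = powerSumsAt (u ℕ.* d) s
      q = period s
      p = H.- q
      pᵘ = p HOps.^ u

    -- The geometric sum gives A (1 - pᵘ) with p = -e^(dst); for odd u the two signs combine, and 1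
    -- - pᵘ = 1 + e^(udst).
    powerSumsAt-odd : ∀ {u} → Odd u → ∀ s → powerSumsAt (u ℕ.* d) s ⊛ den s ≋ powerSumsAt d s ⊛ den (fromℕ u * s)
    powerSumsAt-odd {u} odd-u s = begin
      B ⊛ den s
        ≈⟨ //-rightDividesʳ (A ⊛ r) (B ⊛ den s) ⟨
      B ⊛ den s H.+ A ⊛ r H.+ H.- (A ⊛ r)
        ≈⟨ H.+-cong geometric (HProps.-‿distribʳ-* A r) ⟩
      A H.+ A ⊛ (H.- r)
        ≈⟨ H.+-cong (H.sym (H.*-identityʳ A)) (H.*-congˡ {A} -r≈) ⟩
      A ⊛ H.1# H.+ A ⊛ period (fromℕ u * s)
        ≈⟨ H.trans (H.+-comm (A ⊛ H.1#) (A ⊛ period (fromℕ u * s)))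
             (H.sym (H.distribˡ A (period (fromℕ u * s)) H.1#)) ⟩
      A ⊛ den (fromℕ u * s)
        ∎
      where
      open HReasoning
      open GroupProperties H.+-group using (//-rightDividesʳ; ⁻¹-involutive)
      module HProps = RingProperties H.ring
      A B r : Series
      A = powerSumsAt d s
      B = powerSumsAt (u ℕ.* d) s
      r = (H.- period s) HOps.^ u
      geometric : B ⊛ den s H.+ A ⊛ r ≋ A
      geometric = powerSumsAt-geometric u s
      -r≈ : H.- r ≋ period (fromℕ u * s)
      -r≈ = H.trans (H.-‿cong (HLemmas.odd-^ odd-u (period s)))
        (H.trans (⁻¹-involutive (period s HOps.^ u)) (period-^ s u))

    -- Symmetry of the generating function and cancellation of the denominators.

    denominators : (U V W : Carrier) → Series
    denominators U V W = den (U * W) ⊛ den (V * W) ⊛ den (U * V)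

    numerators : (y U V W : Carrier) → Series
    numerators y U V W = HOps.fromℕ 2 ⊛ e (U * V * W * y) ⊛
      (powerSumsAt d (U * W) ⊛ powerSumsAt d (V * W) ⊛ powerSumsAt d (U * V)) ⊛
      (den (U * V * W) ⊛ den (U * V * W))

    -- Each denominator has its own task: `den (U * W)` clears the Euler values, `den (V * W)`
    -- shortens the power sum of length ud, and `den (U * V)` the one of length wd. The last two are
    -- each traded for a `den (U * V * W)`.
    expression-generating : ∀ y u v w .{{_ : NonZero u}} .{{_ : NonZero w}} → Odd u → Odd w →
      (λ n → expression n y u v w) ⊛ denominators (fromℕ u) (fromℕ v) (fromℕ w) ≋
      numerators y (fromℕ u) (fromℕ v) (fromℕ w)
    expression-generating y u v w odd-u odd-w = begin
      (λ n → expression n y u v w) ⊛ (d₁ ⊛ d₂ ⊛ d₃)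
        ≈⟨ H.*-congʳ {d₁ ⊛ d₂ ⊛ d₃} (expression-⊛ y u v w) ⟩
      P ⊛ S₃ ⊛ (d₁ ⊛ d₂ ⊛ d₃)
        ≈⟨ solve 5 (λ p s d₁ d₂ d₃ → p :* s :* (d₁ :* d₂ :* d₃) := p :* d₁ :* d₂ :* (s :* d₃))
             (λ _ → refl) P S₃ d₁ d₂ d₃ ⟩
      P ⊛ d₁ ⊛ d₂ ⊛ (S₃ ⊛ d₃)
        ≈⟨ H.*-cong (H.*-congʳ {d₂} (σ-characterSums y u v w))
             (H.trans (powerSumsAt-odd odd-w (U * V)) (H.*-congˡ {A₃} (den-cong (*-comm W (U * V))))) ⟩
      E₀ ⊛ A₁ ⊛ S₂ ⊛ d₂ ⊛ (A₃ ⊛ d₀)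
        ≈⟨ H.*-congʳ {A₃ ⊛ d₀} (H.trans (H.*-assoc (E₀ ⊛ A₁) S₂ d₂) (H.*-congˡ {E₀ ⊛ A₁}
             (H.trans (powerSumsAt-odd odd-u (V * W)) (H.*-congˡ {A₂} (den-cong (sym (*-assoc U V W))))))) ⟩
      E₀ ⊛ A₁ ⊛ (A₂ ⊛ d₀) ⊛ (A₃ ⊛ d₀)
        ≈⟨ solve 5 (λ e a₁ a₂ a₃ d₀ → e :* a₁ :* (a₂ :* d₀) :* (a₃ :* d₀) := e :* (a₁ :* a₂ :* a₃) :* (d₀ :* d₀))
             (λ _ → refl) E₀ A₁ A₂ A₃ d₀ ⟩
      E₀ ⊛ (A₁ ⊛ A₂ ⊛ A₃) ⊛ (d₀ ⊛ d₀)
        ∎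
      where
      open HReasoning
      open HSolver
      instance
        d≢0 : NonZero d
        d≢0 = odd⇒nonZero odd-d
        w*d≢0 : NonZero (w ℕ.* d)
        w*d≢0 = ℕ.m*n≢0 w d
      U V W : Carrier
      U = fromℕ u
      V = fromℕ v
      W = fromℕ w
      P S₂ S₃ A₁ A₂ A₃ E₀ d₀ d₁ d₂ d₃ : Series
      P  = σ (U * W) (characterSums y u v w)
      S₂ = powerSumsAt (u ℕ.* d) (V * W)
      S₃ = powerSumsAt (w ℕ.* d) (U * V)
      A₁ = powerSumsAt d (U * W)
      A₂ = powerSumsAt d (V * W)
      A₃ = powerSumsAt d (U * V)
      E₀ = HOps.fromℕ 2 ⊛ e (U * V * W * y)
      d₀ = den (U * V * W)
      d₁ = den (U * W)
      d₂ = den (V * W)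
      d₃ = den (U * V)

    denominators-swap₁₂ : ∀ U V W → denominators U V W ≋ denominators V U W
    denominators-swap₁₂ U V W = H.*-cong (H.*-comm (den (U * W)) (den (V * W))) (den-cong (*-comm U V))

    denominators-swap₂₃ : ∀ U V W → denominators U V W ≋ denominators U W V
    denominators-swap₂₃ U V W = H.trans
      (solve 3 (λ x y z → x :* y :* z := z :* y :* x) (λ _ → refl) (den (U * W)) (den (V * W)) (den (U * V)))
      (H.*-congʳ {den (U * W)} (H.*-congˡ {den (U * V)} (den-cong (*-comm V W))))
      where open HSolver

    -- Apart from the three power sums, the numerator depends on the parameters only through their
    -- product.
    numerators-cong : ∀ y {U V W U′ V′ W′} → U * V * W ≈ U′ * V′ * W′ →
      powerSumsAt d (U * W) ⊛ powerSumsAt d (V * W) ⊛ powerSumsAt d (U * V) ≋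
        powerSumsAt d (U′ * W′) ⊛ powerSumsAt d (V′ * W′) ⊛ powerSumsAt d (U′ * V′) →
      numerators y U V W ≋ numerators y U′ V′ W′
    numerators-cong y UVW≈ A≈ = H.*-cong
      (H.*-cong (H.*-congˡ {HOps.fromℕ 2} (e-cong (*-congʳ UVW≈))) A≈)
      (H.*-cong (den-cong UVW≈) (den-cong UVW≈))

    numerators-swap₁₂ : ∀ y U V W → numerators y U V W ≋ numerators y V U W
    numerators-swap₁₂ y U V W = numerators-cong y (*-congʳ (*-comm U V))
      (H.*-cong (H.*-comm (powerSumsAt d (U * W)) (powerSumsAt d (V * W))) (powerSumsAt-cong d (*-comm U V)))

    numerators-swap₂₃ : ∀ y U V W → numerators y U V W ≋ numerators y U W V
    numerators-swap₂₃ y U V W = numerators-cong y (xy∙z≈xz∙y U V W)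
      (H.trans
        (solve 3 (λ x y z → x :* y :* z := z :* y :* x) (λ _ → refl)
          (powerSumsAt d (U * W)) (powerSumsAt d (V * W)) (powerSumsAt d (U * V)))
        (H.*-congʳ {powerSumsAt d (U * W)} (H.*-congˡ {powerSumsAt d (U * V)} (powerSumsAt-cong d (*-comm V W)))))
      where
      open HSolver
      open CommutativeSemigroupProperties *-commutativeSemigroup using (xy∙z≈xz∙y)

    denominators-cancelʳ : ∀ {f g} U V W → f ⊛ denominators U V W ≋ g ⊛ denominators U V W → f ≋ g
    -- Each of the three factors has constant term 1 + 1, so the product has constant term 2³, with
    -- inverse ½³.
    denominators-cancelʳ {f} {g} U V W = ⊛-cancelʳ f g (denominators U V W) (ι ½ * ι ½ * ι ½) (begin
      two * two * two * (ι ½ * ι ½ * ι ½)      ≈⟨ solve 2 (λ t h → t :* t :* t :* (h :* h :* h) := t :* h :* (t :* h) :* (t :* h))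
                                                  refl two (ι ½) ⟩
      two * ι ½ * (two * ι ½) * (two * ι ½)    ≈⟨ *-cong (*-cong 2*½≈1 2*½≈1) 2*½≈1 ⟩
      1# * 1# * 1#                             ≈⟨ trans (*-identityʳ _) (*-identityʳ 1#) ⟩
      1#                                       ∎)
      where
      open KReasoning
      open KSolver
      two : Carrier
      two = 1# + 1#

    module Swaps (n : ℕ) (y : Carrier) (u v w : ℕ)
      .{{_ : NonZero u}} .{{_ : NonZero v}} .{{_ : NonZero w}}
      (odd-u : Odd u) (odd-v : Odd v) (odd-w : Odd w) where
      private
        U V W : Carrier
        U = fromℕ u
        V = fromℕ v
        W = fromℕ w

      -- Both sides have the same product with `denominators U V W`, which is then cancelled.
      -- Together with `expression-swap₂₃` this generates all permutations of the parameters.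
      expression-swap₁₂ : expression n y u v w ≈ expression n y v u w
      expression-swap₁₂ = denominators-cancelʳ {λ m → expression m y u v w} {λ m → expression m y v u w} U V W
        (H.trans (expression-generating y u v w odd-u odd-w) (H.trans (numerators-swap₁₂ y U V W)
          (H.trans (H.sym (expression-generating y v u w odd-v odd-w))
            (H.*-congˡ {λ m → expression m y v u w} (H.sym (denominators-swap₁₂ U V W)))))) n

      expression-swap₂₃ : expression n y u v w ≈ expression n y u w v
      expression-swap₂₃ = denominators-cancelʳ {λ m → expression m y u v w} {λ m → expression m y u w v} U V W
        (H.trans (expression-generating y u v w odd-u odd-w) (H.trans (numerators-swap₂₃ y U V W)
          (H.trans (H.sym (expression-generating y u w v odd-u odd-v))
            (H.*-congˡ {λ m → expression m y u w v} (H.sym (denominators-swap₂₃ U V W)))))) n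

theorem4p5 : ∀ {c ℓ₁ ℓ₂ : Level} (p : ℕ) → Prime p → Odd p →
    (S : PAdicFields p c ℓ₁ ℓ₂) →
    let open PAdicFields S
        open HeytingField ℂₚ using (_≈_) in
    (d : ℕ) → Odd d →
    (χ : DirichletCharacter (fieldRawRing ℚ̄) d) → DirichletCharacter.Primitive χ →
    let open EulerFor S χ using (expression) in
    (w₁ w₂ w₃ : ℕ) .{{_ : NonZero w₁}} .{{_ : NonZero w₂}} .{{_ : NonZero w₃}} →
    Odd w₁ → Odd w₂ → Odd w₃ →
    (n : ℕ) (y₁ : ∣ℚₚ∣) → y₁ ∈ℤₚ →
    let y = ℚₚ→ℂₚ y₁ in
    (expression n y w₁ w₂ w₃ ≈ expression n y w₁ w₃ w₂) ×
    (expression n y w₁ w₃ w₂ ≈ expression n y w₂ w₁ w₃) ×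
    (expression n y w₂ w₁ w₃ ≈ expression n y w₂ w₃ w₁) ×
    (expression n y w₂ w₃ w₁ ≈ expression n y w₃ w₁ w₂) ×
    (expression n y w₃ w₁ w₂ ≈ expression n y w₃ w₂ w₁)
theorem4p5 p _ _ S d odd-d χ _ w₁ w₂ w₃ odd₁ odd₂ odd₃ n y₁ _ =
    swap₂₃ w₁ w₂ w₃ odd₁ odd₂ odd₃
  , trans (swap₂₃ w₁ w₃ w₂ odd₁ odd₃ odd₂) (swap₁₂ w₁ w₂ w₃ odd₁ odd₂ odd₃)
  , swap₂₃ w₂ w₁ w₃ odd₂ odd₁ odd₃
  , trans (swap₁₂ w₂ w₃ w₁ odd₂ odd₃ odd₁) (swap₂₃ w₃ w₂ w₁ odd₃ odd₂ odd₁)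
  , swap₂₃ w₃ w₁ w₂ odd₃ odd₁ odd₂
  where
  open PAdicFields S
  open CommutativeRing (fieldRing ℂₚ) using (_≈_; trans; reflexive)
  open DirichletCharacter χ using (χ-periodic) renaming (χ to χᶻ)
  periodic : ∀ a → ℚ̄→ℂₚ (χᶻ (+ (d ℕ.+ a))) ≈ ℚ̄→ℂₚ (χᶻ (+ a))
  -- `χ-periodic` adds the period on the right, where `+ a ℤ.+ + d` computes to `+ (a ℕ.+ d)`; the
  -- block decomposition of the sums has it on the left.
  periodic a = trans
    (reflexive (≡.cong (λ b → ℚ̄→ℂₚ (χᶻ (+ b))) (ℕ.+-comm d a)))
    (IsRingHomomorphism.⟦⟧-cong isEmbedding (χ-periodic (+ a)))
  module Expressions = EulerSeries.Periodic (fieldRing ℂₚ) ℚ→ℂₚ (ℚ→ℂₚ-hom S) d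
    (λ a → ℚ̄→ℂₚ (χᶻ (+ a))) odd-d periodic
  open Expressions.Swaps n (ℚₚ→ℂₚ y₁) using ()
    renaming (expression-swap₁₂ to swap₁₂; expression-swap₂₃ to swap₂₃)
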